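{- Let $k\ge 3$ be an integer and let $\mathcal{F}\subseteq\binom{[n]}{k}$ be an intersecting family with $$n\ \ge\ 2k+7k^{2/3}+34k^{1/3}+162.$$ Then $\delta_{k-2}(\mathcal{F})\le n-k+1$. Furthermore, $\delta_{k-2}(\mathcal{F})=n-k+1$ if and only if $\mathcal{F}$ is a complete star.
   Context: $[n]=\{1,\dots,n\}$ and $\binom{[n]}{k}$ is the family of all $k$-element subsets of $[n]$. A family $\mathcal{F}$ is intersecting if $A\cap B\neq\emptyset$ for all $A,B\in\mathcal{F}$. For $S\subseteq[n]$, $d_{\mathcal{F}}(S)=|\{T\in\mathcal{F}: S\subseteq T\}|$, and for $1\le d\le k$, $\delta_d(\mathcal{F})$ is the minimum of $d_{\mathcal{F}}(S)$ over all $d$-element subsets $S\subseteq[n]$. A complete star (centered at $v\in[n]$) is the family of all $k$-subsets of $[n]$ containing $v$. -}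

module Defs where

open import Data.Nat using (ℕ; zero; suc; _+_; _*_; _∸_; _^_; _≤_; _<_; _⊓_; _≟_)
open import Data.Bool using (Bool; true; false; _∧_; T?)
open import Data.List using (List; []; _∷_; _++_; map; filter; length)
open import Data.Vec using ([]; _∷_)
open import Data.Fin using (Fin)
open import Data.Fin.Subset using (Subset; inside; outside; _⊆_; _∩_; ∣_∣; Nonempty; _∈_)
open import Data.Fin.Subset.Properties using (_⊆?_)
open import Data.Product using (_×_; ∃)
open import Relation.Nullary using (does)
open import Relation.Binary.PropositionalEquality using (_≡_)
open import Function.Bundles using (_⇔_)

Family : ℕ → Set
Family n = Subset n → Bool

_∈F_ : ∀ {n} → Subset n → Family n → Set
T ∈F F = F T ≡ true

Uniform : ∀ {n} → ℕ → Family n → Set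
Uniform k F = ∀ T → T ∈F F → ∣ T ∣ ≡ k

Intersecting : ∀ {n} → Family n → Set
Intersecting F = ∀ A B → A ∈F F → B ∈F F → Nonempty (A ∩ B)

allSubsets : (n : ℕ) → List (Subset n)
allSubsets zero = [] ∷ []
allSubsets (suc n) = map (outside ∷_) (allSubsets n) ++ map (inside ∷_) (allSubsets n)

degree : ∀ {n} → Family n → Subset n → ℕ
degree {n} F S = length (filter (λ X → T? (F X ∧ does (S ⊆? X))) (allSubsets n))

subsetsOfSize : (n d : ℕ) → List (Subset n)
subsetsOfSize n d = filter (λ S → ∣ S ∣ ≟ d) (allSubsets n)

-- minimum of a list of naturals; the default is only used for the empty list
-- (which never occurs in the theorem, since d ≤ n there).
minimumOr : ℕ → List ℕ → ℕ
minimumOr def [] = def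
minimumOr def (x ∷ []) = x
minimumOr def (x ∷ y ∷ xs) = x ⊓ minimumOr def (y ∷ xs)

δ : ∀ {n} → ℕ → Family n → ℕ
δ {n} d F = minimumOr 0 (map (degree F) (subsetsOfSize n d))

CompleteStar : ∀ {n} → ℕ → Family n → Set
CompleteStar {n} k F = ∃ λ (v : Fin n) → ∀ T → (T ∈F F) ⇔ (∣ T ∣ ≡ k × v ∈ T)

-- n ≥ 2k + 7 k^{2/3} + 34 k^{1/3} + 162, stated exactly over ℕ.
-- With t = k^{1/3} and f(t) = 7t² + 34t + 2k + 162 (increasing, continuous
-- for t ≥ 0), n ≥ f(k^{1/3}) iff n ≥ f(q) for every rational q = m/p ≥ 0
-- with q³ ≤ k; multiplying by p³ gives the condition below.
SizeBound : ℕ → ℕ → Set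
SizeBound n k = ∀ (m p : ℕ) → 0 < p → m ^ 3 ≤ k * p ^ 3 →
  7 * m ^ 2 * p + 34 * m * p ^ 2 + (2 * k + 162) * p ^ 3 ≤ n * p ^ 3

{-# OPTIONS --safe #-}
-- Put k = 2 + j.  If every j-set T has degree at least n - k + 1, then the link graph of T is
-- either a star with all its edges present, or it contains a 2-matching.  Attach to T a "token":
-- the centre of the star, or the 4-element support of a 2-matching.  If disjoint T₁ and T₂ avoid
-- each other's tokens, then their tokens are equal, for otherwise F has disjoint members.
--
-- Split the ground set in two parts.  Consider the 0-1 matrix indexed by pairs of tokens (x , y)
-- whose entry says that x ≠ y and that some j-set in the left part avoids x and has token y.  Any
-- such matrix either has about log₂ (#tokens) columns covering all rows, or as few rows such that
-- every column has a zero in one of them.  As n - 2k exceeds eight times this logarithm, each part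
-- contains j-sets avoiding that many tokens at once, and this forces one token t shared by all
-- j-sets in the right part that avoid t.  Since 2-matchings can be chosen with a different support,
-- t is the centre v of stars.  Exchanging elements of a j-set one at a time, all j-sets avoiding v
-- have stars centred at v, and so v belongs to all members of F.
module Submission where

open import Defs
open import Data.Nat hiding (∣_-_∣)
open import Data.Nat.Properties
open import Data.Nat.DivMod using (m≡m%n+[m/n]*n; m%n<n; /-monoˡ-≤; m/n*n≤m; m*n/n≡m)
open import Data.Nat.ListAction using (sum)
open import Data.Nat.Tactic.RingSolver using (solve-∀)
open import Algebra.Properties.CommutativeSemigroup +-commutativeSemigroup using (x∙yz≈y∙xz)
open import Data.Bool as Bool using (true; false; _∧_; T?)
open import Data.Bool.Properties using (T-≡; T-∧)
open import Data.Fin as Fin using (Fin; zero; suc)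
import Data.Fin.Properties as Fin
open import Data.Fin.Subset
open import Data.Fin.Subset.Properties
open import Data.List using (List; []; _∷_; _++_; filter; length; map; cartesianProductWith)
open import Data.List.Properties using (length-map; length-++; length-++-sucʳ; filter-++)
open import Data.List.Membership.Propositional using (find; lose) renaming (_∈_ to _∈ˡ_)
open import Data.List.Membership.Propositional.Properties
  using (∈-∃++; ∈-++⁺ˡ; ∈-++⁺ʳ; ∈-++⁻; ∈-filter⁺; ∈-filter⁻; ∈-map⁺; ∈-map⁻; ∈-cartesianProductWith⁺)
open import Data.List.Relation.Unary.All as All using ([])
open import Data.List.Relation.Unary.All.Properties using () renaming (map⁺ to All-map⁺)
open import Data.List.Relation.Unary.AllPairs using ([]; _∷_)
open import Data.List.Relation.Unary.Any using (here; there; any?)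
open import Data.List.Relation.Unary.Unique.Propositional using (Unique)
import Data.List.Relation.Unary.Unique.Propositional.Properties as Unique
open import Data.Product using (_×_; _,_; ∃; proj₁; proj₂)
open import Data.Sum using (_⊎_; inj₁; inj₂; [_,_]′)
open import Data.Unit using (tt)
open import Data.Vec using ([]; _∷_; here; there)
open import Data.Vec.Properties using (∷-injectiveʳ; ≡-dec)
open import Function using (_∘_; id)
open import Function.Bundles using (_⇔_; mk⇔; Equivalence)
open import Relation.Nullary using (Dec; yes; no; ¬_; ¬?; contradiction; does)
open import Relation.Nullary.Decidable using (_×-dec_; map′; dec-true; toSum)
open import Relation.Unary using (Decidable)
open import Relation.Binary.PropositionalEquality

private variable
  A B : Set
  n : ℕ

-- A partner of the head is cut out of `ys`. No later element can need it, since `inj` would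
-- identify that element with the head.
length-≤-by-injection : (R : A → B → Set) → (∀ {a a′ b} → R a b → R a′ b → a ≡ a′) →
  ∀ {xs} → Unique xs → ∀ ys → (∀ {a} → a ∈ˡ xs → ∃ λ b → b ∈ˡ ys × R a b) → length xs ≤ length ys
length-≤-by-injection R inj [] ys f = z≤n
length-≤-by-injection R inj {x ∷ xs} (x∉xs ∷ uxs) ys f with f (here refl)
... | b , b∈ys , Rxb with ∈-∃++ b∈ys
... | us , vs , refl = ≤-trans (s≤s (length-≤-by-injection R inj uxs (us ++ vs) g))
                               (≤-reflexive (sym (length-++-sucʳ us b vs)))
  where
  g : ∀ {a} → a ∈ˡ xs → ∃ λ c → c ∈ˡ (us ++ vs) × R a c
  g {a} a∈xs with f (there a∈xs)
  ... | c , c∈ , Rac with ∈-++⁻ us c∈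
  ... | inj₁ p = c , ∈-++⁺ˡ p , Rac
  ... | inj₂ (there p) = c , ∈-++⁺ʳ us p , Rac
  ... | inj₂ (here refl) = contradiction (inj Rxb Rac) (All.lookup x∉xs a∈xs)

-- A dichotomy for finite 0-1 matrices

count : {P : A → Set} → Decidable P → List A → ℕ
count P? xs = length (filter P? xs)

count-complement : {P : A → Set} (P? : Decidable P) (xs : List A) →
  count P? xs + count (¬? ∘ P?) xs ≡ length xs
count-complement P? [] = refl
count-complement P? (x ∷ xs) with P? x
... | yes _ = cong suc (count-complement P? xs)
... | no _ = trans (+-suc (count P? xs) _) (cong suc (count-complement P? xs))

rowSum : {E : A → B → Set} → (∀ a b → Dec (E a b)) → List A → List B → ℕ
rowSum E? xs ys = sum (map (λ a → count (E? a) ys) xs)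

-- Double counting: peeling off one column at a time turns the sum over rows into a sum over
-- columns.
rowSum-∷ : {E : A → B → Set} (E? : ∀ a b → Dec (E a b)) → ∀ xs b ys →
  rowSum E? xs (b ∷ ys) ≡ count (λ a → E? a b) xs + rowSum E? xs ys
rowSum-∷ E? [] b ys = refl
rowSum-∷ E? (x ∷ xs) b ys with E? x b
... | yes _ = cong suc (trans (cong (count (E? x) ys +_) (rowSum-∷ E? xs b ys))
                              (x∙yz≈y∙xz (count (E? x) ys) (count (λ a → E? a b) xs) _))
... | no _ = trans (cong (count (E? x) ys +_) (rowSum-∷ E? xs b ys))
                   (x∙yz≈y∙xz (count (E? x) ys) (count (λ a → E? a b) xs) _)

rowSum-lower : {E : A → B → Set} (E? : ∀ a b → Dec (E a b)) → ∀ xs ys →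
  (∀ {b} → b ∈ˡ ys → length xs ≤ 2 * count (λ a → E? a b) xs) →
  length ys * length xs ≤ 2 * rowSum E? xs ys
rowSum-lower E? xs [] h = z≤n
rowSum-lower E? xs (b ∷ ys) h = begin
  length xs + length ys * length xs                           ≤⟨ +-mono-≤ (h (here refl)) (rowSum-lower E? xs ys (h ∘ there)) ⟩
  2 * count (λ a → E? a b) xs + 2 * rowSum E? xs ys           ≡⟨ *-distribˡ-+ 2 (count (λ a → E? a b) xs) _ ⟨
  2 * (count (λ a → E? a b) xs + rowSum E? xs ys)             ≡⟨ cong (2 *_) (rowSum-∷ E? xs b ys) ⟨
  2 * rowSum E? xs (b ∷ ys)                                   ∎
  where open ≤-Reasoning

-- Strictness yields one unit per row, kept as the summand `length xs`; it makes the comparison with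
-- `rowSum-lower` strict.
rowSum-upper : {E : A → B → Set} (E? : ∀ a b → Dec (E a b)) → ∀ xs ys →
  (∀ {a} → a ∈ˡ xs → 2 * count (E? a) ys < length ys) →
  length xs + 2 * rowSum E? xs ys ≤ length xs * length ys
rowSum-upper E? [] ys h = z≤n
rowSum-upper E? (x ∷ xs) ys h = begin
  suc (length xs) + 2 * (count (E? x) ys + rowSum E? xs ys)        ≡⟨ regroup (length xs) (count (E? x) ys) _ ⟩
  suc (2 * count (E? x) ys) + (length xs + 2 * rowSum E? xs ys)    ≤⟨ +-mono-≤ (h (here refl)) (rowSum-upper E? xs ys (h ∘ there)) ⟩
  length ys + length xs * length ys                                ∎
  where
  open ≤-Reasoning
  regroup : ∀ l c r → suc l + 2 * (c + r) ≡ suc (2 * c) + (l + 2 * r)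
  regroup = solve-∀

-- Averaging: if all columns are at least half full, then so is the matrix, and hence some row.
∃-majority-row : {E : A → B → Set} (E? : ∀ a b → Dec (E a b)) → ∀ xs ys → 0 < length xs →
  (∀ {b} → b ∈ˡ ys → length xs ≤ 2 * count (λ a → E? a b) xs) →
  ∃ λ a → a ∈ˡ xs × length ys ≤ 2 * count (E? a) ys
∃-majority-row E? xs ys 0<xs h with any? (λ a → length ys ≤? 2 * count (E? a) ys) xs
... | yes p = find p
... | no ¬p = contradiction (begin-strict
  length ys * length xs            ≤⟨ rowSum-lower E? xs ys h ⟩
  2 * rowSum E? xs ys              <⟨ m<n+m _ 0<xs ⟩
  length xs + 2 * rowSum E? xs ys  ≤⟨ rowSum-upper E? xs ys (λ a∈ → ≰⇒> (¬p ∘ lose a∈)) ⟩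
  length xs * length ys            ≡⟨ *-comm (length xs) _ ⟩
  length ys * length xs            ∎) (<-irrefl refl)
  where open ≤-Reasoning

length-discard-majority : {P : A → Set} (P? : Decidable P) (xs : List A) (N : ℕ) →
  length xs < 2 ^ suc N → length xs ≤ 2 * count P? xs → count (¬? ∘ P?) xs < 2 ^ N
length-discard-majority P? xs N small major = *-cancelˡ-< 2 _ _ (begin-strict
  2 * u                ≡⟨ cong (u +_) (+-identityʳ u) ⟩
  u + u                ≤⟨ +-monoˡ-≤ u u≤c ⟩
  c + u                ≡⟨ count-complement P? xs ⟩
  length xs            <⟨ small ⟩
  2 * 2 ^ N            ∎)
  where
  open ≤-Reasoning
  c = count P? xs
  u = count (¬? ∘ P?) xs
  u≤c : u ≤ c
  u≤c = +-cancelˡ-≤ c u c (begin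
    c + u      ≡⟨ count-complement P? xs ⟩
    length xs  ≤⟨ major ⟩
    2 * c      ≡⟨ cong (c +_) (+-identityʳ c) ⟩
    c + c      ∎)

Covers : (A → B → Set) → List A → List B → Set
Covers E xs cs = ∀ {a} → a ∈ˡ xs → ∃ λ b → b ∈ˡ cs × E a b

-- Greedy choice of majority rows. The hypothesis compares each column with all of `xs`, so it
-- survives the deletion of covered columns, and each choice at least halves the columns left.
rows-cover : {E : A → B → Set} (E? : ∀ a b → Dec (E a b)) → ∀ xs → 0 < length xs → ∀ N ys → length ys < 2 ^ N →
  (∀ {b} → b ∈ˡ ys → length xs ≤ 2 * count (λ a → E? a b) xs) →
  ∃ λ rs → length rs ≤ N × (∀ {a} → a ∈ˡ rs → a ∈ˡ xs) × Covers (λ b a → E a b) ys rs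
rows-cover E? xs 0<xs N [] _ _ = [] , z≤n , (λ ()) , λ ()
rows-cover E? xs 0<xs zero (_ ∷ _) (s≤s ()) _
rows-cover E? xs 0<xs (suc N) ys@(_ ∷ _) small h with ∃-majority-row E? xs ys 0<xs h
... | r , r∈xs , major with rows-cover E? xs 0<xs N (filter (¬? ∘ E? r) ys)
                              (length-discard-majority (E? r) ys N small major)
                              (h ∘ proj₁ ∘ ∈-filter⁻ (¬? ∘ E? r))
... | rs , len , rs⊆xs , cover = r ∷ rs , s≤s len , (λ { (here refl) → r∈xs ; (there p) → rs⊆xs p }) , cover′
  where
  cover′ : Covers _ ys (r ∷ rs)
  cover′ {b} b∈ with E? r b
  ... | yes e = r , here refl , e
  ... | no ¬e = let (a , a∈ , e) = cover (∈-filter⁺ (¬? ∘ E? r) b∈ ¬e) in a , there a∈ , e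

-- Pick columns greedily, each covering half of the rows that are left.  If this gets stuck, every
-- column misses at least half of the remaining rows, so that rows can be picked greedily instead.
greedy-dichotomy : {E : A → B → Set} (E? : ∀ a b → Dec (E a b)) → ∀ N ys → length ys < 2 ^ N →
  ∀ M xs → length xs < 2 ^ M →
  (∃ λ cs → length cs ≤ M × (∀ {b} → b ∈ˡ cs → b ∈ˡ ys) × Covers E xs cs) ⊎
  (∃ λ rs → length rs ≤ N × (∀ {a} → a ∈ˡ rs → a ∈ˡ xs) × Covers (λ b a → ¬ E a b) ys rs)
greedy-dichotomy E? N ys small-ys M [] small-xs = inj₁ ([] , z≤n , (λ ()) , λ ())
greedy-dichotomy E? N ys small-ys zero (_ ∷ _) (s≤s ())
greedy-dichotomy {A = A} {E = E} E? N ys small-ys (suc M) xs@(_ ∷ _) small-xs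
  with any? (λ b → length xs ≤? 2 * count (λ a → E? a b) xs) ys
... | no ¬p = inj₂ (rows-cover (λ a b → ¬? (E? a b)) xs z<s N ys small-ys minority)
  where
  minority : ∀ {b} → b ∈ˡ ys → length xs ≤ 2 * count (λ a → ¬? (E? a b)) xs
  minority {b} b∈ = begin
    length xs      ≡⟨ count-complement (λ a → E? a b) xs ⟨
    c + u          ≤⟨ +-monoˡ-≤ u c≤u ⟩
    u + u          ≡⟨ cong (u +_) (+-identityʳ u) ⟨
    2 * u          ∎
    where
    open ≤-Reasoning
    c = count (λ a → E? a b) xs
    u = count (λ a → ¬? (E? a b)) xs
    c≤u : c ≤ u
    c≤u = +-cancelˡ-≤ c c u (begin
      c + c      ≡⟨ cong (c +_) (+-identityʳ c) ⟨
      2 * c      ≤⟨ <⇒≤ (≰⇒> (¬p ∘ lose b∈)) ⟩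
      length xs  ≡⟨ count-complement (λ a → E? a b) xs ⟨
      c + u      ∎)
... | yes p with find p
... | b , b∈ys , major
  with greedy-dichotomy E? N ys small-ys M (filter (λ a → ¬? (E? a b)) xs)
         (length-discard-majority (λ a → E? a b) xs M small-xs major)
... | inj₂ (rs , len , rs⊆ , cover) = inj₂ (rs , len , proj₁ ∘ ∈-filter⁻ (λ a → ¬? (E? a b)) ∘ rs⊆ , cover)
... | inj₁ (cs , len , cs⊆ , cover) =
  inj₁ (b ∷ cs , s≤s len , (λ { (here refl) → b∈ys ; (there q) → cs⊆ q }) , cover′)
  where
  cover′ : Covers E xs (b ∷ cs)
  cover′ {a} a∈ with E? a b
  ... | yes e = b , here refl , e
  ... | no ¬e = let (c , c∈ , e) = cover (∈-filter⁺ (λ a → ¬? (E? a b)) a∈ ¬e) in c , there c∈ , e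

-- Tokens shared between two sides, abstractly

module TokenGame
  {L R X : Set} (_≟X_ : (x y : X) → Dec (x ≡ y))
  (AvoidsL : L → X → Set) (AvoidsR : R → X → Set)
  (tokL : L → X) (TokR : R → X → Set)
  (agree : ∀ {l r y} → TokR r y → AvoidsL l y → AvoidsR r (tokL l) → tokL l ≡ y)
  (response? : ∀ x y → Dec (∃ λ l → AvoidsL l x × tokL l ≡ y))
  (toks : List X) (tokL∈ : ∀ l → tokL l ∈ˡ toks) (TokR∈ : ∀ {r y} → TokR r y → y ∈ˡ toks)
  (tokR : ∀ r → ∃ (TokR r))
  (N : ℕ) (few : length toks < 2 ^ N)
  (avoidL : ∀ ts → length ts ≤ suc N → (∀ {t} → t ∈ˡ ts → t ∈ˡ toks) → ∃ λ l → ∀ {t} → t ∈ˡ ts → AvoidsL l t)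
  (avoidR : ∀ ts → length ts ≤ N → (∀ {t} → t ∈ˡ ts → t ∈ˡ toks) → ∃ λ r → ∀ {t} → t ∈ˡ ts → AvoidsR r t)
  where

  -- The entry in row `x` and column `y`. On the left a token is a function value, which keeps the
  -- entries decidable; on the right it is a relation, so that `forced-token` speaks of every token
  -- of `r`.
  Response : X → X → Set
  Response x y = x ≢ y × ∃ λ l → AvoidsL l x × tokL l ≡ y

  forced-token : ∃ λ t → t ∈ˡ toks × (∀ {r y} → AvoidsR r t → TokR r y → y ≡ t)
  forced-token with greedy-dichotomy {E = Response} (λ x y → ¬? (x ≟X y) ×-dec response? x y) N toks few N toks few
  -- Covering columns are impossible: let `r` avoid them all and have token `x`. The column covering
  -- `x` gives an `l` with a token other than `x`, although `l` and `r` avoid each other's tokens.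
  ... | inj₁ (cs , len , cs⊆ , cover) =
    let (r , avoid) = avoidR cs len cs⊆
        (x , rx) = tokR r
        (y , y∈ , x≢y , l , lx , l≡y) = cover (TokR∈ rx)
    in contradiction (trans (sym (agree rx lx (subst (AvoidsR r) (sym l≡y) (avoid y∈)))) l≡y) x≢y
  ... | inj₂ (xs , len , xs⊆ , cover) = t , TokR∈ r₀t , forced
    where
    -- The column `tokL l` has a zero in some row `x` of `xs`, but `l` itself is a response there
    -- unless `x` equals `tokL l`.
    tok∈xs : ∀ l → (∀ {x} → x ∈ˡ xs → AvoidsL l x) → tokL l ∈ˡ xs
    tok∈xs l avoid with cover (tokL∈ l)
    ... | x , x∈ , ¬resp with x ≟X tokL l
    ... | yes refl = x∈
    ... | no x≢ = contradiction (x≢ , l , avoid x∈ , refl) ¬resp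

    -- One more token than the rows has to be avoided here, hence `suc N` in `avoidL`.
    avoid∷ : ∀ {y} → y ∈ˡ toks → ∃ λ l → ∀ {x} → x ∈ˡ (y ∷ xs) → AvoidsL l x
    avoid∷ y∈ = avoidL (_ ∷ xs) (s≤s len) λ { (here refl) → y∈ ; (there p) → xs⊆ p }

    r₀ = proj₁ (avoidR xs len xs⊆)
    r₀-avoids = proj₂ (avoidR xs len xs⊆)
    t = proj₁ (tokR r₀)
    r₀t = proj₂ (tokR r₀)

    tok≡t : ∀ l → AvoidsL l t → (∀ {x} → x ∈ˡ xs → AvoidsL l x) → tokL l ≡ t
    tok≡t l lt avoid = agree r₀t lt (r₀-avoids (tok∈xs l avoid))

    t∈xs : t ∈ˡ xs
    t∈xs = let (l , avoid) = avoid∷ (TokR∈ r₀t)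
           in subst (_∈ˡ xs) (tok≡t l (avoid (here refl)) (avoid ∘ there)) (tok∈xs l (avoid ∘ there))

    -- An `l` avoiding `y` and `xs` also avoids `t`, so its token is `t`. As `r` avoids `t` and `l`
    -- avoids `y`, agreement gives `y ≡ t`.
    forced : ∀ {r y} → AvoidsR r t → TokR r y → y ≡ t
    forced {r} rt ry =
      let (l , avoid) = avoid∷ (TokR∈ ry)
          l≡t = tok≡t l (avoid (there t∈xs)) (avoid ∘ there)
      in trans (sym (agree ry (avoid (here refl)) (subst (AvoidsR r) (sym l≡t) rt))) l≡t

-- Cardinalities of subsets

∣p∪q∣≤∣p∣+∣q∣ : ∀ (p q : Subset n) → ∣ p ∪ q ∣ ≤ ∣ p ∣ + ∣ q ∣
∣p∪q∣≤∣p∣+∣q∣ [] [] = z≤n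
∣p∪q∣≤∣p∣+∣q∣ (outside ∷ p) (outside ∷ q) = ∣p∪q∣≤∣p∣+∣q∣ p q
∣p∪q∣≤∣p∣+∣q∣ (outside ∷ p) (inside ∷ q) = ≤-trans (s≤s (∣p∪q∣≤∣p∣+∣q∣ p q)) (≤-reflexive (sym (+-suc ∣ p ∣ ∣ q ∣)))
∣p∪q∣≤∣p∣+∣q∣ (inside ∷ p) (outside ∷ q) = s≤s (∣p∪q∣≤∣p∣+∣q∣ p q)
∣p∪q∣≤∣p∣+∣q∣ (inside ∷ p) (inside ∷ q) = s≤s (≤-trans (∣p∪q∣≤∣p∣+∣q∣ p q) (+-monoʳ-≤ ∣ p ∣ (n≤1+n _)))

x∈p─q⇒x∉q : ∀ {x} (p q : Subset n) → x ∈ p ─ q → x ∉ q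
x∈p─q⇒x∉q (_ ∷ p) (outside ∷ q) (there x∈) (there x∈q) = x∈p─q⇒x∉q p q x∈ x∈q
x∈p─q⇒x∉q (_ ∷ p) (inside ∷ q) (there x∈) (there x∈q) = x∈p─q⇒x∉q p q x∈ x∈q

q⊆p⇒∣p∣≡∣q∣+∣p─q∣ : ∀ (p q : Subset n) → q ⊆ p → ∣ p ∣ ≡ ∣ q ∣ + ∣ p ─ q ∣
q⊆p⇒∣p∣≡∣q∣+∣p─q∣ [] [] _ = refl
q⊆p⇒∣p∣≡∣q∣+∣p─q∣ (outside ∷ p) (outside ∷ q) h = q⊆p⇒∣p∣≡∣q∣+∣p─q∣ p q (drop-∷-⊆ h)
q⊆p⇒∣p∣≡∣q∣+∣p─q∣ (inside ∷ p) (outside ∷ q) h = trans (cong suc (q⊆p⇒∣p∣≡∣q∣+∣p─q∣ p q (drop-∷-⊆ h))) (sym (+-suc ∣ q ∣ _))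
q⊆p⇒∣p∣≡∣q∣+∣p─q∣ (outside ∷ p) (inside ∷ q) h with () ← h here
q⊆p⇒∣p∣≡∣q∣+∣p─q∣ (inside ∷ p) (inside ∷ q) h = cong suc (q⊆p⇒∣p∣≡∣q∣+∣p─q∣ p q (drop-∷-⊆ h))

∣p∣≤∣p─q∣+∣q∣ : ∀ (p q : Subset n) → ∣ p ∣ ≤ ∣ p ─ q ∣ + ∣ q ∣
∣p∣≤∣p─q∣+∣q∣ p q = ≤-trans (p⊆q⇒∣p∣≤∣q∣ p⊆) (∣p∪q∣≤∣p∣+∣q∣ (p ─ q) q)
  where
  p⊆ : p ⊆ (p ─ q) ∪ q
  p⊆ {x} x∈ with x ∈? q
  ... | yes x∈q = q⊆p∪q (p ─ q) q x∈q
  ... | no x∉q = p⊆p∪q q (x∈p∧x∉q⇒x∈p─q x∈ x∉q)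

abstract
  0<∣p∣⇒Nonempty : ∀ (p : Subset n) → 0 < ∣ p ∣ → Nonempty p
  0<∣p∣⇒Nonempty {n} p 0<p with nonempty? p
  ... | yes ne = ne
  ... | no empty = contradiction (subst (λ q → 0 < ∣ q ∣) (Empty-unique empty) 0<p) (subst (λ c → ¬ 0 < c) (sym (∣⊥∣≡0 n)) (λ ()))

  ∃∉ : ∀ (p : Subset n) → ∣ p ∣ < n → ∃ λ x → x ∉ p
  ∃∉ p small = let (x , x∈) = 0<∣p∣⇒Nonempty (∁ p) (subst (0 <_) (sym (∣∁p∣≡n∸∣p∣ p)) (m<n⇒0<n∸m small))
               in x , x∈∁p⇒x∉p x∈

  ∃⊆-of-size : ∀ (p : Subset n) {j} → j ≤ ∣ p ∣ → ∃ λ q → q ⊆ p × ∣ q ∣ ≡ j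
  ∃⊆-of-size {n} p {zero} _ = ⊥ , ⊥⊆ , ∣⊥∣≡0 n
  ∃⊆-of-size (outside ∷ p) {suc j} j≤ = let (q , q⊆ , eq) = ∃⊆-of-size p j≤ in outside ∷ q , out⊆ q⊆ , eq
  ∃⊆-of-size (inside ∷ p) {suc j} (s≤s j≤) = let (q , q⊆ , eq) = ∃⊆-of-size p j≤ in inside ∷ q , in⊆in q⊆ , cong suc eq

  ∃⊇-of-size : ∀ (p : Subset n) {j} → ∣ p ∣ ≤ j → j ≤ n → ∃ λ q → p ⊆ q × ∣ q ∣ ≡ j
  ∃⊇-of-size {n} p {j} p≤j j≤n =
    let (q , q⊆ , eq) = ∃⊆-of-size (∁ p) {n ∸ j} (subst (n ∸ j ≤_) (sym (∣∁p∣≡n∸∣p∣ p)) (∸-monoʳ-≤ n p≤j))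
    in ∁ q , (λ x∈p → x∉p⇒x∈∁p (λ x∈q → x∈∁p⇒x∉p (q⊆ x∈q) x∈p))
     , trans (∣∁p∣≡n∸∣p∣ q) (trans (cong (n ∸_) eq) (m∸[m∸n]≡n j≤n))

∣p∪⁅x⁆∣≡1+∣p∣ : ∀ {p : Subset n} {x} → x ∉ p → ∣ p ∪ ⁅ x ⁆ ∣ ≡ suc ∣ p ∣
∣p∪⁅x⁆∣≡1+∣p∣ {p = p} {x} x∉p = ≤-antisym
  (≤-trans (∣p∪q∣≤∣p∣+∣q∣ p ⁅ x ⁆) (≤-reflexive (trans (cong (∣ p ∣ +_) (∣⁅x⁆∣≡1 x)) (+-comm ∣ p ∣ 1))))
  (p⊂q⇒∣p∣<∣q∣ (p⊆p∪q ⁅ x ⁆ , x , q⊆p∪q p ⁅ x ⁆ (x∈⁅x⁆ x) , x∉p))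

-- A third element would survive the removal of `x` and `y`.
size-2 : ∀ {p : Subset n} {x y z} → ∣ p ∣ ≡ 2 → x ∈ p → y ∈ p → x ≢ y → z ∈ p → z ≡ x ⊎ z ≡ y
size-2 {p = p} {x} {y} {z} eq x∈ y∈ x≢y z∈ with z Fin.≟ x | z Fin.≟ y
... | yes z≡x | _ = inj₁ z≡x
... | no _ | yes z≡y = inj₂ z≡y
... | no z≢x | no z≢y = contradiction eq (>⇒≢ 2<p)
  where
  y∈′ : y ∈ p - x
  y∈′ = x∈p∧x≢y⇒x∈p-y y∈ (x≢y ∘ sym)
  z∈′ : z ∈ p - x - y
  z∈′ = x∈p∧x≢y⇒x∈p-y (x∈p∧x≢y⇒x∈p-y z∈ z≢x) z≢y
  2<p : 2 < ∣ p ∣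
  2<p = ≤-trans (s≤s (≤-trans (s≤s (≤-trans (s≤s z≤n) (x∈p⇒∣p-x∣<∣p∣ z∈′))) (x∈p⇒∣p-x∣<∣p∣ y∈′))) (x∈p⇒∣p-x∣<∣p∣ x∈)

Disjoint : Subset n → Subset n → Set
Disjoint p q = ∀ {x} → x ∈ p → x ∉ q

∈-⋃ : ∀ {t : Subset n} {ts x} → t ∈ˡ ts → x ∈ t → x ∈ ⋃ ts
∈-⋃ {ts = t ∷ ts} (here refl) x∈ = p⊆p∪q (⋃ ts) x∈
∈-⋃ {ts = t ∷ ts} (there t∈) x∈ = q⊆p∪q t (⋃ ts) (∈-⋃ t∈ x∈)

∣⋃∣≤ : ∀ (ts : List (Subset n)) {c} → (∀ {t} → t ∈ˡ ts → ∣ t ∣ ≤ c) → ∣ ⋃ ts ∣ ≤ length ts * c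
∣⋃∣≤ {n} [] _ = ≤-reflexive (∣⊥∣≡0 n)
∣⋃∣≤ (t ∷ ts) h = ≤-trans (∣p∪q∣≤∣p∣+∣q∣ t (⋃ ts)) (+-mono-≤ (h (here refl)) (∣⋃∣≤ ts (h ∘ there)))

x∉p∪q : ∀ {p q : Subset n} {x} → x ∉ p → x ∉ q → x ∉ p ∪ q
x∉p∪q {p = p} {q} x∉p x∉q x∈ = [ x∉p , x∉q ]′ (x∈p∪q⁻ p q x∈)

x∉p∪q⇒x∉p : ∀ {p q : Subset n} {x} → x ∉ p ∪ q → x ∉ p
x∉p∪q⇒x∉p {q = q} x∉ = x∉ ∘ p⊆p∪q q

x∉p∪q⇒x∉q : ∀ {p q : Subset n} {x} → x ∉ p ∪ q → x ∉ q
x∉p∪q⇒x∉q {p = p} {q} x∉ = x∉ ∘ q⊆p∪q p q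

∪-lub : ∀ {p q r : Subset n} → p ⊆ r → q ⊆ r → p ∪ q ⊆ r
∪-lub {p = p} {q} p⊆r q⊆r x∈ = [ p⊆r , q⊆r ]′ (x∈p∪q⁻ p q x∈)

⁅x⁆⊆ : ∀ {p : Subset n} {x} → x ∈ p → ⁅ x ⁆ ⊆ p
⁅x⁆⊆ {p = p} {x} x∈p y∈ = subst (_∈ p) (sym (x∈⁅y⁆⇒x≡y x y∈)) x∈p

⁅⁆-injective : ∀ {x y : Fin n} → ⁅ x ⁆ ≡ ⁅ y ⁆ → x ≡ y
⁅⁆-injective {x = x} {y} eq = x∈⁅y⁆⇒x≡y y (subst (x ∈_) eq (x∈⁅x⁆ x))

∣p∣≡1+∣p-x∣ : ∀ {p : Subset n} {x} → x ∈ p → ∣ p ∣ ≡ suc ∣ p - x ∣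
∣p∣≡1+∣p-x∣ {p = p} {x} x∈p =
  trans (q⊆p⇒∣p∣≡∣q∣+∣p─q∣ p ⁅ x ⁆ (⁅x⁆⊆ x∈p)) (cong (_+ ∣ p - x ∣) (∣⁅x⁆∣≡1 x))

disjoint⇒∣p∪q∣≡∣p∣+∣q∣ : ∀ {p q : Subset n} → Disjoint p q → ∣ p ∪ q ∣ ≡ ∣ p ∣ + ∣ q ∣
disjoint⇒∣p∪q∣≡∣p∣+∣q∣ {p = p} {q} d = trans (q⊆p⇒∣p∣≡∣q∣+∣p─q∣ (p ∪ q) p (p⊆p∪q q))
  (cong (λ r → ∣ p ∣ + ∣ r ∣) (⊆-antisym
    (λ {x} x∈ → [ (λ x∈p → contradiction x∈p (x∈p─q⇒x∉q (p ∪ q) p x∈)) , id ]′ (x∈p∪q⁻ p q (p─q⊆p (p ∪ q) p x∈)))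
    (λ x∈q → x∈p∧x∉q⇒x∈p─q (q⊆p∪q p q x∈q) (λ x∈p → d x∈p x∈q))))

∣p∪⁅x⁆∣≤ : ∀ {p : Subset n} {x c} → ∣ p ∣ ≤ c → ∣ p ∪ ⁅ x ⁆ ∣ ≤ suc c
∣p∪⁅x⁆∣≤ {p = p} {x} {c} p≤ = ≤-trans (∣p∪q∣≤∣p∣+∣q∣ p ⁅ x ⁆)
  (≤-trans (+-mono-≤ p≤ (≤-reflexive (∣⁅x⁆∣≡1 x))) (≤-reflexive (+-comm c 1)))

∣p∪q∣≤ : ∀ {p q : Subset n} {c d} → ∣ p ∣ ≤ c → ∣ q ∣ ≤ d → ∣ p ∪ q ∣ ≤ c + d
∣p∪q∣≤ {p = p} {q} p≤ q≤ = ≤-trans (∣p∪q∣≤∣p∣+∣q∣ p q) (+-mono-≤ p≤ q≤)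

replace : Subset n → Fin n → Fin n → Subset n
replace p a b = (p - a) ∪ ⁅ b ⁆

module _ {p : Subset n} {a b : Fin n} where

  ∣replace∣ : a ∈ p → b ∉ p → ∣ replace p a b ∣ ≡ ∣ p ∣
  ∣replace∣ a∈p b∉p = trans (∣p∪⁅x⁆∣≡1+∣p∣ (b∉p ∘ p─q⊆p p ⁅ a ⁆)) (sym (∣p∣≡1+∣p-x∣ a∈p))

  ∈-replace⁻ : ∀ {x} → x ∈ replace p a b → (x ∈ p × x ≢ a) ⊎ x ≡ b
  ∈-replace⁻ x∈ with x∈p∪q⁻ (p - a) ⁅ b ⁆ x∈
  ... | inj₁ x∈′ = inj₁ (p─q⊆p p ⁅ a ⁆ x∈′ , x∉⁅y⁆⇒x≢y (x∈p─q⇒x∉q p ⁅ a ⁆ x∈′))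
  ... | inj₂ x∈b = inj₂ (x∈⁅y⁆⇒x≡y b x∈b)

∈-spoke⁻ : ∀ {T : Subset n} {v x y} → y ∈ (T ∪ ⁅ v ⁆) ∪ ⁅ x ⁆ → y ∈ T ⊎ y ≡ v ⊎ y ≡ x
∈-spoke⁻ {T = T} {v} {x} y∈ with x∈p∪q⁻ (T ∪ ⁅ v ⁆) ⁅ x ⁆ y∈
... | inj₂ y∈x = inj₂ (inj₂ (x∈⁅y⁆⇒x≡y x y∈x))
... | inj₁ y∈′ with x∈p∪q⁻ T ⁅ v ⁆ y∈′
... | inj₁ y∈T = inj₁ y∈T
... | inj₂ y∈v = inj₂ (inj₁ (x∈⁅y⁆⇒x≡y v y∈v))

-- Enumerations of elements and of subsets

elements : Subset n → List (Fin n)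
elements [] = []
elements (outside ∷ p) = map suc (elements p)
elements (inside ∷ p) = zero ∷ map suc (elements p)

length-elements : ∀ (p : Subset n) → length (elements p) ≡ ∣ p ∣
length-elements [] = refl
length-elements (outside ∷ p) = trans (length-map suc (elements p)) (length-elements p)
length-elements (inside ∷ p) = cong suc (trans (length-map suc (elements p)) (length-elements p))

∈-elements⁺ : ∀ {p : Subset n} {x} → x ∈ p → x ∈ˡ elements p
∈-elements⁺ {p = _ ∷ _} here = here refl
∈-elements⁺ {p = outside ∷ p} (there x∈) = ∈-map⁺ suc (∈-elements⁺ x∈)
∈-elements⁺ {p = inside ∷ p} (there x∈) = there (∈-map⁺ suc (∈-elements⁺ x∈))

∈-elements⁻ : ∀ {p : Subset n} {x} → x ∈ˡ elements p → x ∈ p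
∈-elements⁻ {p = outside ∷ p} x∈ with (_ , y∈ , refl) ← ∈-map⁻ suc x∈ = there (∈-elements⁻ y∈)
∈-elements⁻ {p = inside ∷ p} (here refl) = here
∈-elements⁻ {p = inside ∷ p} (there x∈) with (_ , y∈ , refl) ← ∈-map⁻ suc x∈ = there (∈-elements⁻ y∈)

elements-unique : ∀ (p : Subset n) → Unique (elements p)
elements-unique [] = []
elements-unique (outside ∷ p) = Unique.map⁺ Fin.suc-injective (elements-unique p)
elements-unique (inside ∷ p) = All-map⁺ (All.universal (λ _ ()) (elements p)) ∷ Unique.map⁺ Fin.suc-injective (elements-unique p)

∈-allSubsets : ∀ (p : Subset n) → p ∈ˡ allSubsets n
∈-allSubsets [] = here refl
∈-allSubsets (outside ∷ p) = ∈-++⁺ˡ (∈-map⁺ (outside ∷_) (∈-allSubsets p))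
∈-allSubsets (inside ∷ p) = ∈-++⁺ʳ (map (outside ∷_) (allSubsets _)) (∈-map⁺ (inside ∷_) (∈-allSubsets p))

allSubsets-unique : ∀ n → Unique (allSubsets n)
allSubsets-unique zero = [] ∷ []
allSubsets-unique (suc n) = Unique.++⁺ (Unique.map⁺ ∷-injectiveʳ u) (Unique.map⁺ ∷-injectiveʳ u) disjoint
  where
  u = allSubsets-unique n
  disjoint : ∀ {p} → ¬ (p ∈ˡ map (outside ∷_) (allSubsets n) × p ∈ˡ map (inside ∷_) (allSubsets n))
  disjoint (p∈ , q∈) with ∈-map⁻ (outside ∷_) p∈ | ∈-map⁻ (inside ∷_) q∈
  ... | _ , _ , refl | _ , _ , ()

∈-subsetsOfSize⁺ : ∀ {p : Subset n} {d} → ∣ p ∣ ≡ d → p ∈ˡ subsetsOfSize n d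
∈-subsetsOfSize⁺ {p = p} {d} eq = ∈-filter⁺ (λ S → ∣ S ∣ ≟ d) (∈-allSubsets p) eq

∈-subsetsOfSize⁻ : ∀ {p : Subset n} {d} → p ∈ˡ subsetsOfSize n d → ∣ p ∣ ≡ d
∈-subsetsOfSize⁻ {n} {d = d} p∈ = proj₂ (∈-filter⁻ (λ S → ∣ S ∣ ≟ d) {xs = allSubsets n} p∈)

-- Counting subsets of a given size

count-map : ∀ {P : B → Set} {Q : A → Set} (P? : Decidable P) (Q? : Decidable Q) (f : A → B) →
  (∀ x → does (P? (f x)) ≡ does (Q? x)) → ∀ xs → count P? (map f xs) ≡ count Q? xs
count-map P? Q? f h [] = refl
count-map P? Q? f h (x ∷ xs) with does (P? (f x)) | does (Q? x) | h x
... | true | true | _ = cong suc (count-map P? Q? f h xs)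
... | false | false | _ = count-map P? Q? f h xs

#subsets : ℕ → ℕ → ℕ
#subsets n d = length (subsetsOfSize n d)

#subsets-split : ∀ n d → #subsets (suc n) d ≡
  count (λ S → ∣ S ∣ ≟ d) (map (outside ∷_) (allSubsets n)) + count (λ S → ∣ S ∣ ≟ d) (map (inside ∷_) (allSubsets n))
#subsets-split n d = trans
  (cong length (filter-++ (λ S → ∣ S ∣ ≟ d) (map (outside ∷_) (allSubsets n)) (map (inside ∷_) (allSubsets n))))
  (length-++ (filter (λ S → ∣ S ∣ ≟ d) (map (outside ∷_) (allSubsets n))))

#subsets-suc-zero : ∀ n → #subsets (suc n) 0 ≡ #subsets n 0
#subsets-suc-zero n = trans (#subsets-split n 0) (trans
  (cong₂ _+_ (count-map (λ S → ∣ S ∣ ≟ 0) (λ S → ∣ S ∣ ≟ 0) (outside ∷_) (λ _ → refl) (allSubsets n)) (none (allSubsets n)))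
  (+-identityʳ _))
  where
  none : ∀ ps → count (λ S → ∣ S ∣ ≟ 0) (map (inside ∷_) ps) ≡ 0
  none [] = refl
  none (p ∷ ps) = none ps

-- Pascal's rule, by whether the first element belongs to the subset.
#subsets-suc-suc : ∀ n d → #subsets (suc n) (suc d) ≡ #subsets n (suc d) + #subsets n d
#subsets-suc-suc n d = trans (#subsets-split n (suc d)) (cong₂ _+_
  (count-map (λ S → ∣ S ∣ ≟ suc d) (λ S → ∣ S ∣ ≟ suc d) (outside ∷_) (λ _ → refl) (allSubsets n))
  (count-map (λ S → ∣ S ∣ ≟ suc d) (λ S → ∣ S ∣ ≟ d) (inside ∷_) (λ _ → refl) (allSubsets n)))

#subsets-0 : ∀ n → #subsets n 0 ≡ 1
#subsets-0 zero = refl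
#subsets-0 (suc n) = trans (#subsets-suc-zero n) (#subsets-0 n)

-- The left side consists of the two leading terms of the binomial expansion of the right side.
^-suc-lower : ∀ n d → n ^ suc d + suc d * n ^ d ≤ suc n ^ suc d
^-suc-lower n zero = ≤-reflexive (arith n)
  where
  arith : ∀ n → n * 1 + (1 + 0) * 1 ≡ suc n * 1
  arith = solve-∀
^-suc-lower n (suc d) = begin
  n * n ^ suc d + suc (suc d) * n ^ suc d                  ≤⟨ m≤m+n _ (suc d * n ^ d) ⟩
  n * n ^ suc d + suc (suc d) * n ^ suc d + suc d * n ^ d  ≡⟨ arith n d (n ^ d) ⟩
  suc n * (n ^ suc d + suc d * n ^ d)                      ≤⟨ *-monoʳ-≤ (suc n) (^-suc-lower n d) ⟩
  suc n * suc n ^ suc d                                    ∎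
  where
  open ≤-Reasoning
  arith : ∀ n d x → n * (n * x) + suc (suc d) * (n * x) + suc d * x ≡ suc n * (n * x + suc d * x)
  arith = solve-∀

-- Induction by Pascal's rule, whose two summands are absorbed by `^-suc-lower`. The factorial
-- stands on the left to avoid division.
#subsets-≤ : ∀ n d → d ! * #subsets n d ≤ n ^ d
#subsets-≤ n zero = ≤-reflexive (trans (+-identityʳ _) (#subsets-0 n))
#subsets-≤ zero (suc d) = ≤-reflexive (*-zeroʳ (suc d !))
#subsets-≤ (suc n) (suc d) = begin
  suc d ! * #subsets (suc n) (suc d)                        ≡⟨ cong (suc d ! *_) (#subsets-suc-suc n d) ⟩
  suc d ! * (#subsets n (suc d) + #subsets n d)             ≡⟨ arith (d !) d _ _ ⟩
  suc d ! * #subsets n (suc d) + suc d * (d ! * #subsets n d)  ≤⟨ +-mono-≤ (#subsets-≤ n (suc d)) (*-monoʳ-≤ (suc d) (#subsets-≤ n d)) ⟩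
  n ^ suc d + suc d * n ^ d                                 ≤⟨ ^-suc-lower n d ⟩
  suc n ^ suc d                                             ∎
  where
  open ≤-Reasoning
  arith : ∀ f d x y → suc d * f * (x + y) ≡ suc d * f * x + suc d * (f * y)
  arith = solve-∀

-- Degrees

edges : Family n → Subset n → List (Subset n)
edges {n} F S = filter (λ X → T? (F X ∧ does (S ⊆? X))) (allSubsets n)

fromDoes : {P : Set} (P? : Dec P) → Bool.T (does P?) → P
fromDoes (yes p) _ = p

module _ {F : Family n} {S : Subset n} where

  ∈-edges⁺ : ∀ {X} → X ∈F F → S ⊆ X → X ∈ˡ edges F S
  ∈-edges⁺ {X} X∈F S⊆X = ∈-filter⁺ (λ X → T? (F X ∧ does (S ⊆? X))) (∈-allSubsets X)
    (Equivalence.from T-∧ (Equivalence.from T-≡ X∈F , Equivalence.from T-≡ (dec-true (S ⊆? X) S⊆X)))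

  ∈-edges⁻ : ∀ {X} → X ∈ˡ edges F S → X ∈F F × S ⊆ X
  ∈-edges⁻ X∈ =
    let (FX , S⊆X) = Equivalence.to T-∧ (proj₂ (∈-filter⁻ (λ X → T? (F X ∧ does (S ⊆? X))) {xs = allSubsets n} X∈))
    in Equivalence.to T-≡ FX , fromDoes (S ⊆? _) S⊆X

  degree-≤ : ∀ Ys → (∀ {X} → X ∈F F → S ⊆ X → X ∈ˡ Ys) → degree F S ≤ length Ys
  degree-≤ Ys h = length-≤-by-injection _≡_ (λ { refl refl → refl })
    (Unique.filter⁺ (λ X → T? (F X ∧ does (S ⊆? X))) (allSubsets-unique n)) Ys
    (λ {X} X∈ → let (X∈F , S⊆X) = ∈-edges⁻ X∈ in X , h X∈F S⊆X , refl)

minimumOr-≤ : ∀ {d xs x} → x ∈ˡ xs → minimumOr d xs ≤ x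
minimumOr-≤ {xs = x ∷ []} (here refl) = ≤-refl
minimumOr-≤ {xs = x ∷ y ∷ xs} (here refl) = m⊓n≤m x _
minimumOr-≤ {xs = x ∷ y ∷ xs} (there y∈) = ≤-trans (m⊓n≤n x _) (minimumOr-≤ y∈)

-- The member `x` excludes the empty list, whose minimum is the default.
≤-minimumOr : ∀ {d xs x b} → x ∈ˡ xs → (∀ {y} → y ∈ˡ xs → b ≤ y) → b ≤ minimumOr d xs
≤-minimumOr {xs = x ∷ []} _ h = h (here refl)
≤-minimumOr {xs = x ∷ y ∷ xs} _ h = ⊓-glb (h (here refl)) (≤-minimumOr {xs = y ∷ xs} (here refl) (h ∘ there))

δ-≤ : ∀ {d} (F : Family n) {S} → ∣ S ∣ ≡ d → δ d F ≤ degree F S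
δ-≤ F {S} eq = minimumOr-≤ (∈-map⁺ (degree F) (∈-subsetsOfSize⁺ {p = S} eq))

≤-δ : ∀ {d b} (F : Family n) {S} → ∣ S ∣ ≡ d → (∀ S′ → ∣ S′ ∣ ≡ d → b ≤ degree F S′) → b ≤ δ d F
≤-δ {d = d} {b} F {S} eq h = ≤-minimumOr (∈-map⁺ (degree F) (∈-subsetsOfSize⁺ {p = S} eq)) bound
  where
  bound : ∀ {y} → y ∈ˡ map (degree F) (subsetsOfSize _ d) → b ≤ y
  bound y∈ with (S′ , S′∈ , refl) ← ∈-map⁻ (degree F) y∈ = h S′ (∈-subsetsOfSize⁻ S′∈)

length-cartesianProductWith : ∀ {C : Set} (f : A → B → C) xs ys →
  length (cartesianProductWith f xs ys) ≡ length xs * length ys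
length-cartesianProductWith f [] ys = refl
length-cartesianProductWith f (x ∷ xs) ys = trans (length-++ (map (f x) ys))
  (cong₂ _+_ (length-map (f x) ys) (length-cartesianProductWith f xs ys))

module _ {j : ℕ} (F : Family n) (uniform : Uniform (2 + j) F) where

  -- An X ∈ F containing a j-set T is regarded as the edge X ─ T of the link graph of T.

  ∣edge∣≡2 : ∀ {T X} → ∣ T ∣ ≡ j → X ∈F F → T ⊆ X → ∣ X ─ T ∣ ≡ 2
  ∣edge∣≡2 {T} {X} ∣T∣ X∈F T⊆X = +-cancelˡ-≡ j ∣ X ─ T ∣ 2 (begin
    j + ∣ X ─ T ∣      ≡⟨ cong (_+ ∣ X ─ T ∣) ∣T∣ ⟨
    ∣ T ∣ + ∣ X ─ T ∣  ≡⟨ q⊆p⇒∣p∣≡∣q∣+∣p─q∣ X T T⊆X ⟨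
    ∣ X ∣              ≡⟨ uniform X X∈F ⟩
    2 + j              ≡⟨ +-comm 2 j ⟩
    j + 2              ∎)
    where open ≡-Reasoning

  edge-form : ∀ {T X x} → ∣ T ∣ ≡ j → X ∈F F → T ⊆ X → x ∈ X → x ∉ T →
    ∃ λ y → y ∈ X × y ∉ T × y ≢ x × X ≡ (T ∪ ⁅ x ⁆) ∪ ⁅ y ⁆
  edge-form {T} {X} {x} ∣T∣ X∈F T⊆X x∈X x∉T =
    y , y∈X , y∉T , y≢x , ⊆-antisym X⊆ (∪-lub (∪-lub T⊆X (⁅x⁆⊆ x∈X)) (⁅x⁆⊆ y∈X))
    where
    x∈e : x ∈ X ─ T
    x∈e = x∈p∧x∉q⇒x∈p─q x∈X x∉T
    rest = 0<∣p∣⇒Nonempty ((X ─ T) - x)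
      (≤-reflexive (sym (suc-injective (trans (sym (∣p∣≡1+∣p-x∣ x∈e)) (∣edge∣≡2 ∣T∣ X∈F T⊆X)))))
    y = proj₁ rest
    y∈e : y ∈ X ─ T
    y∈e = p─q⊆p (X ─ T) ⁅ x ⁆ (proj₂ rest)
    y≢x : y ≢ x
    y≢x = x∉⁅y⁆⇒x≢y (x∈p─q⇒x∉q (X ─ T) ⁅ x ⁆ (proj₂ rest))
    y∈X = p─q⊆p X T y∈e
    y∉T = x∈p─q⇒x∉q X T y∈e
    X⊆ : X ⊆ (T ∪ ⁅ x ⁆) ∪ ⁅ y ⁆
    X⊆ {z} z∈X with z ∈? T
    ... | yes z∈T = p⊆p∪q ⁅ y ⁆ (p⊆p∪q ⁅ x ⁆ z∈T)
    ... | no z∉T with size-2 (∣edge∣≡2 ∣T∣ X∈F T⊆X) x∈e y∈e (y≢x ∘ sym) (x∈p∧x∉q⇒x∈p─q z∈X z∉T)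
    ... | inj₁ refl = p⊆p∪q ⁅ y ⁆ (q⊆p∪q T ⁅ x ⁆ (x∈⁅x⁆ x))
    ... | inj₂ refl = q⊆p∪q (T ∪ ⁅ x ⁆) ⁅ y ⁆ (x∈⁅x⁆ y)

  -- Every edge within `Q` arises from an ordered pair of elements of `Q`. The count is wasteful,
  -- but it will only be applied to sets of at most 10 elements.
  degree-≤-in : ∀ {T} (Q : Subset n) → ∣ T ∣ ≡ j → (∀ {X} → X ∈F F → T ⊆ X → X ⊆ T ∪ Q) → degree F T ≤ ∣ Q ∣ * ∣ Q ∣
  degree-≤-in {T} Q ∣T∣ inside-Q = subst (degree F T ≤_)
    (trans (length-cartesianProductWith pair (elements Q) (elements Q)) (cong₂ _*_ (length-elements Q) (length-elements Q)))
    (degree-≤ {F = F} {S = T} (cartesianProductWith pair (elements Q) (elements Q)) listed)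
    where
    pair : Fin n → Fin n → Subset n
    pair x y = (T ∪ ⁅ x ⁆) ∪ ⁅ y ⁆
    ∈Q : ∀ {X x} → X ∈F F → T ⊆ X → x ∈ X → x ∉ T → x ∈ Q
    ∈Q X∈F T⊆X x∈X x∉T = [ (λ x∈T → contradiction x∈T x∉T) , id ]′ (x∈p∪q⁻ T Q (inside-Q X∈F T⊆X x∈X))
    listed : ∀ {X} → X ∈F F → T ⊆ X → X ∈ˡ cartesianProductWith pair (elements Q) (elements Q)
    listed {X} X∈F T⊆X =
      let (x , x∈e) = 0<∣p∣⇒Nonempty (X ─ T) (subst (0 <_) (sym (∣edge∣≡2 ∣T∣ X∈F T⊆X)) z<s)
          x∈X = p─q⊆p X T x∈e
          x∉T = x∈p─q⇒x∉q X T x∈e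
          (y , y∈X , y∉T , _ , X≡) = edge-form ∣T∣ X∈F T⊆X x∈X x∉T
      in subst (_∈ˡ _) (sym X≡) (∈-cartesianProductWith⁺ pair
           (∈-elements⁺ (∈Q X∈F T⊆X x∈X x∉T)) (∈-elements⁺ (∈Q X∈F T⊆X y∈X y∉T)))

  -- All edges contain `v`, so each is determined by its other end.
  degree-≤-star : ∀ {T v} (Q : Subset n) → ∣ T ∣ ≡ j → v ∉ T →
    (∀ {X} → X ∈F F → T ⊆ X → v ∈ X) →
    (∀ {x} → x ∉ T → x ≢ v → ((T ∪ ⁅ v ⁆) ∪ ⁅ x ⁆) ∈F F → x ∈ Q) →
    degree F T ≤ ∣ Q ∣
  degree-≤-star {T} {v} Q ∣T∣ v∉T centre leaf = subst (degree F T ≤_)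
    (trans (length-map spoke (elements Q)) (length-elements Q))
    (degree-≤ {F = F} {S = T} (map spoke (elements Q)) listed)
    where
    spoke : Fin n → Subset n
    spoke x = (T ∪ ⁅ v ⁆) ∪ ⁅ x ⁆
    listed : ∀ {X} → X ∈F F → T ⊆ X → X ∈ˡ map spoke (elements Q)
    listed X∈F T⊆X with edge-form ∣T∣ X∈F T⊆X (centre X∈F T⊆X) v∉T
    ... | y , y∈X , y∉T , y≢v , refl = ∈-map⁺ spoke (∈-elements⁺ (leaf y∉T y≢v X∈F))

-- Families in which all j-sets have high degree

module HighDegree {n j : ℕ} (F : Family n) (uniform : Uniform (2 + j) F) (intersecting : Intersecting F)
  (high : ∀ T → ∣ T ∣ ≡ j → n ∸ (2 + j) + 1 ≤ degree F T)
  (N : ℕ) (13≤N : 13 ≤ N) (large : 2 * (2 + j) + 8 * N ≤ n)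
  (few : #subsets n 1 + #subsets n 4 < 2 ^ N) where

  -- The slack 104 is 8 · 13, from `13≤N`. It lets `fresh` avoid two `j`-sets and up to 103 further
  -- elements.
  j+j+104≤n : j + j + 104 ≤ n
  j+j+104≤n = begin
    j + j + 8 * 13       ≤⟨ +-monoʳ-≤ (j + j) (*-monoʳ-≤ 8 13≤N) ⟩
    j + j + 8 * N        ≤⟨ +-monoˡ-≤ (8 * N) (m≤m+n (j + j) 4) ⟩
    j + j + 4 + 8 * N    ≡⟨ cong (_+ 8 * N) (arith j) ⟩
    2 * (2 + j) + 8 * N  ≤⟨ large ⟩
    n                    ∎
    where
    open ≤-Reasoning
    arith : ∀ j → j + j + 4 ≡ 2 * (2 + j)
    arith = solve-∀

  -- One part must hold a `j`-set beside `suc N` tokens of at most 4 elements, the other a `j`-set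
  -- beside `N` of them. Together this is exactly the left side of `large`.
  two-parts : j + suc N * 4 + (j + N * 4) ≤ n
  two-parts = ≤-trans (≤-reflexive (arith j N)) large
    where
    arith : ∀ j N → j + suc N * 4 + (j + N * 4) ≡ 2 * (2 + j) + 8 * N
    arith = solve-∀

  abstract
    fresh : ∀ {c} (p : Subset n) → ∣ p ∣ ≤ j + j + c → c < 104 → ∃ λ x → x ∉ p
    fresh p p≤ c< = ∃∉ p (<-≤-trans (≤-<-trans p≤ (+-monoʳ-< (j + j) c<)) j+j+104≤n)

    fresh-near : ∀ {c} (p : Subset n) → ∣ p ∣ ≤ c + j → c < 104 → ∃ λ x → x ∉ p
    fresh-near {c} p p≤ c< = fresh p (≤-trans p≤ (≤-trans (m≤n+m (c + j) j) (≤-reflexive (arith j c)))) c<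
      where
      arith : ∀ j c → j + (c + j) ≡ j + j + c
      arith = solve-∀

  103≤high : 103 ≤ n ∸ (2 + j) + 1
  103≤high = +-monoˡ-≤ 1 (m+n≤o⇒m≤o∸n 102 (≤-trans (≤-trans (m≤n+m (104 + j) j) (≤-reflexive (arith j))) j+j+104≤n))
    where
    arith : ∀ j → j + (104 + j) ≡ j + j + 104
    arith = solve-∀

  -- Stars and matchings in link graphs

  record Star (T : Subset n) (v : Fin n) : Set where
    field
      centre∉ : v ∉ T
      centre : ∀ {X} → X ∈F F → T ⊆ X → v ∈ X
      full : ∀ {x} → x ∉ T → x ≢ v → ((T ∪ ⁅ v ⁆) ∪ ⁅ x ⁆) ∈F F
  open Star

  -- `τ` is only the support: different matchings on the same four elements give the same token.
  record Matching (T τ : Subset n) : Set where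
    field
      left right : Subset n
      left∈F : left ∈F F
      right∈F : right ∈F F
      T⊆left : T ⊆ left
      T⊆right : T ⊆ right
      disjoint : Disjoint (left ─ T) (right ─ T)
      support : τ ≡ (left ─ T) ∪ (right ─ T)
  open Matching

  -- If the edge from `v` to `x` were missing, all leaves would lie outside `T`, `v` and `x`. That
  -- leaves at most n - k edges, one fewer than `high` demands.
  star-if-centre : ∀ {T v} → ∣ T ∣ ≡ j → v ∉ T → (∀ {X} → X ∈F F → T ⊆ X → v ∈ X) → Star T v
  star-if-centre {T} {v} ∣T∣ v∉T c = record { centre∉ = v∉T ; centre = c ; full = full′ }
    where
    full′ : ∀ {x} → x ∉ T → x ≢ v → ((T ∪ ⁅ v ⁆) ∪ ⁅ x ⁆) ∈F F
    full′ {x} x∉T x≢v with F ((T ∪ ⁅ v ⁆) ∪ ⁅ x ⁆) Bool.≟ true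
    ... | yes ∈F = ∈F
    ... | no ∉F = contradiction (≤-trans (high T ∣T∣) (degree-≤-star F uniform Q ∣T∣ v∉T c leaf)) (<⇒≱ small)
      where
      P = (T ∪ ⁅ v ⁆) ∪ ⁅ x ⁆
      Q = ∁ P
      leaf : ∀ {y} → y ∉ T → y ≢ v → ((T ∪ ⁅ v ⁆) ∪ ⁅ y ⁆) ∈F F → y ∈ Q
      leaf y∉T y≢v y∈F = x∉p⇒x∈∁p (x∉p∪q (x∉p∪q y∉T (x≢y⇒x∉⁅y⁆ y≢v))
        (λ y∈x → ∉F (subst (λ z → ((T ∪ ⁅ v ⁆) ∪ ⁅ z ⁆) ∈F F) (x∈⁅y⁆⇒x≡y x y∈x) y∈F)))
      ∣P∣ : ∣ P ∣ ≡ 2 + j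
      ∣P∣ = trans (∣p∪⁅x⁆∣≡1+∣p∣ (x∉p∪q x∉T (x≢y⇒x∉⁅y⁆ x≢v))) (cong suc (trans (∣p∪⁅x⁆∣≡1+∣p∣ v∉T) (cong suc ∣T∣)))
      small : ∣ Q ∣ < n ∸ (2 + j) + 1
      small = ≤-reflexive (trans (cong suc (trans (∣∁p∣≡n∸∣p∣ P) (cong (n ∸_) ∣P∣))) (+-comm 1 _))

  -- Otherwise all edges lie within `Q` and number at most 10 · 10 = 100, while `high` gives at
  -- least 103. The bound 10 admits three edges and a set of 4 elements.
  ∃-edge-leaving : ∀ {T} Q → ∣ T ∣ ≡ j → ∣ Q ∣ ≤ 10 → ∃ λ X → X ∈F F × T ⊆ X × ∃ λ x → x ∈ X ─ T × x ∉ Q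
  ∃-edge-leaving {T} Q ∣T∣ Q≤ with anySubset? (λ X → (F X Bool.≟ true) ×-dec (T ⊆? X) ×-dec nonempty? (X ─ T ─ Q))
  ... | yes (X , X∈F , T⊆X , x , x∈) = X , X∈F , (λ {_} → T⊆X) , x , p─q⊆p (X ─ T) Q x∈ , x∈p─q⇒x∉q (X ─ T) Q x∈
  ... | no none = contradiction
      (≤-trans 103≤high (≤-trans (high T ∣T∣) (≤-trans (degree-≤-in F uniform Q ∣T∣ inside-Q) (*-mono-≤ Q≤ Q≤))))
      (<⇒≱ {100} {103} (s≤s (m≤n+m 100 2)))
    where
    inside-Q : ∀ {X} → X ∈F F → T ⊆ X → X ⊆ T ∪ Q
    inside-Q {X} X∈F T⊆X {x} x∈X with x ∈? T | x ∈? Q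
    ... | yes x∈T | _ = p⊆p∪q Q x∈T
    ... | no _ | yes x∈Q = q⊆p∪q T Q x∈Q
    ... | no x∉T | no x∉Q = contradiction (X , X∈F , (λ {_} → T⊆X) , x , x∈p∧x∉q⇒x∈p─q (x∈p∧x∉q⇒x∈p─q x∈X x∉T) x∉Q) none

  -- If the graph is not a star, take an edge ab, an edge avoiding a and an edge avoiding b.  An edge
  -- xy with x outside these three edges and outside Q is disjoint from one of them: otherwise all
  -- three contain y, and y is a or b.
  star-or-matchings : ∀ T → ∣ T ∣ ≡ j → (∃ λ v → Star T v) ⊎ (∀ Q → ∣ Q ∣ ≤ 4 → ∃ λ τ → Matching T τ × τ ≢ Q)
  star-or-matchings T ∣T∣ with Fin.any? (λ v → ¬? (v ∈? T) ×-dec ¬? (anySubset? (avoiding? v)))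
    where
    avoiding? : ∀ v X → Dec (X ∈F F × T ⊆ X × v ∉ X)
    avoiding? v X = (F X Bool.≟ true) ×-dec (T ⊆? X) ×-dec ¬? (v ∈? X)
  ... | yes (v , v∉T , none) = inj₁ (v , star-if-centre ∣T∣ v∉T centre′)
    where
    centre′ : ∀ {X} → X ∈F F → T ⊆ X → v ∈ X
    centre′ {X} X∈F T⊆X with v ∈? X
    ... | yes v∈X = v∈X
    ... | no v∉X = contradiction (X , X∈F , (λ {_} → T⊆X) , v∉X) none
  ... | no ¬star = inj₂ build
    where
    avoiding : ∀ {v} → v ∉ T → ∃ λ X → X ∈F F × T ⊆ X × v ∉ X
    avoiding {v} v∉T with anySubset? (λ X → (F X Bool.≟ true) ×-dec (T ⊆? X) ×-dec ¬? (v ∈? X))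
    ... | yes found = found
    ... | no none = contradiction (v , v∉T , none) ¬star

    build : ∀ Q → ∣ Q ∣ ≤ 4 → ∃ λ τ → Matching T τ × τ ≢ Q
    build Q Q≤ with ∃-edge-leaving ⊥ ∣T∣ (≤-trans (≤-reflexive (∣⊥∣≡0 n)) z≤n)
    ... | X₀ , X₀∈F , T⊆X₀ , a , a∈e₀ , _ with edge-form F uniform ∣T∣ X₀∈F T⊆X₀ (p─q⊆p X₀ T a∈e₀) (x∈p─q⇒x∉q X₀ T a∈e₀)
    ... | b , b∈X₀ , b∉T , b≢a , _ with avoiding (x∈p─q⇒x∉q X₀ T a∈e₀) | avoiding b∉T
    ... | X₁ , X₁∈F , T⊆X₁ , a∉X₁ | X₂ , X₂∈F , T⊆X₂ , b∉X₂
      with ∃-edge-leaving (((X₀ ─ T) ∪ (X₁ ─ T)) ∪ ((X₂ ─ T) ∪ Q)) ∣T∣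
             (∣p∪q∣≤ {p = (X₀ ─ T) ∪ (X₁ ─ T)}
               (∣p∪q∣≤ {p = X₀ ─ T} (≤-reflexive (∣edge∣≡2 F uniform ∣T∣ X₀∈F T⊆X₀)) (≤-reflexive (∣edge∣≡2 F uniform ∣T∣ X₁∈F T⊆X₁)))
               (∣p∪q∣≤ {p = X₂ ─ T} (≤-reflexive (∣edge∣≡2 F uniform ∣T∣ X₂∈F T⊆X₂)) Q≤))
    ... | X₃ , X₃∈F , T⊆X₃ , x , x∈e₃ , x∉ = result
      where
      x∉₀ : x ∉ X₀ ─ T
      x∉₀ = x∉p∪q⇒x∉p (x∉p∪q⇒x∉p x∉)
      x∉₁ : x ∉ X₁ ─ T
      x∉₁ = x∉p∪q⇒x∉q {p = X₀ ─ T} (x∉p∪q⇒x∉p x∉)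
      x∉₂ : x ∉ X₂ ─ T
      x∉₂ = x∉p∪q⇒x∉p (x∉p∪q⇒x∉q {p = (X₀ ─ T) ∪ (X₁ ─ T)} x∉)
      x∉Q : x ∉ Q
      x∉Q = x∉p∪q⇒x∉q {p = X₂ ─ T} (x∉p∪q⇒x∉q {p = (X₀ ─ T) ∪ (X₁ ─ T)} x∉)

      -- Success gives a support containing `x`, hence different from `Q`; failure gives a common
      -- end of the two edges.
      attempt : ∀ {Z} → Z ∈F F → T ⊆ Z → (∃ λ τ → Matching T τ × τ ≢ Q) ⊎ (∃ λ y → y ∈ X₃ ─ T × y ∈ Z ─ T)
      attempt {Z} Z∈F T⊆Z with nonempty? ((X₃ ─ T) ∩ (Z ─ T))
      ... | yes (y , y∈) = inj₂ (y , x∈p∩q⁻ (X₃ ─ T) (Z ─ T) y∈)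
      ... | no empty = inj₁ (_ , record
        { left∈F = X₃∈F ; right∈F = Z∈F ; T⊆left = T⊆X₃ ; T⊆right = T⊆Z
        ; disjoint = λ y∈ y∈′ → empty (_ , x∈p∩q⁺ (y∈ , y∈′)) ; support = refl }
        , λ eq → x∉Q (subst (x ∈_) eq (p⊆p∪q (Z ─ T) x∈e₃)))

      same : ∀ {y z e} → y ∈ X₃ ─ T → y ≢ x → z ∈ X₃ ─ T → z ∈ e → x ∉ e → z ≡ y
      same y∈ y≢x z∈ z∈e x∉e with size-2 (∣edge∣≡2 F uniform ∣T∣ X₃∈F T⊆X₃) x∈e₃ y∈ (y≢x ∘ sym) z∈
      ... | inj₁ refl = contradiction z∈e x∉e
      ... | inj₂ z≡y = z≡y

      result : ∃ λ τ → Matching T τ × τ ≢ Q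
      result with attempt X₀∈F T⊆X₀ | attempt X₁∈F T⊆X₁ | attempt X₂∈F T⊆X₂
      ... | inj₁ m | _ | _ = m
      ... | inj₂ _ | inj₁ m | _ = m
      ... | inj₂ _ | inj₂ _ | inj₁ m = m
      ... | inj₂ (y , y∈₃ , y∈₀) | inj₂ (z , z∈₃ , z∈₁) | inj₂ (w , w∈₃ , w∈₂)
        with refl ← same y∈₃ (λ { refl → x∉₀ y∈₀ }) z∈₃ z∈₁ x∉₁
           | refl ← same y∈₃ (λ { refl → x∉₀ y∈₀ }) w∈₃ w∈₂ x∉₂
        with size-2 (∣edge∣≡2 F uniform ∣T∣ X₀∈F T⊆X₀) a∈e₀ (x∈p∧x∉q⇒x∈p─q b∈X₀ b∉T) (b≢a ∘ sym) y∈₀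
      ... | inj₁ refl = contradiction (p─q⊆p X₁ T z∈₁) a∉X₁
      ... | inj₂ refl = contradiction (p─q⊆p X₂ T w∈₂) b∉X₂

  -- Tokens and their agreement

  Token : Subset n → Subset n → Set
  Token T τ = (∃ λ v → Star T v × τ ≡ ⁅ v ⁆) ⊎ Matching T τ

  meets : ∀ {T X Z} → X ∈F F → Z ∈F F → Disjoint T X → ∃ λ y → y ∈ X × y ∈ Z ─ T
  meets {T} {X} {Z} X∈F Z∈F T∩X =
    let (y , y∈) = intersecting X Z X∈F Z∈F
        (y∈X , y∈Z) = x∈p∩q⁻ X Z y∈
    in y , y∈X , x∈p∧x∉q⇒x∈p─q y∈Z (λ y∈T → T∩X y∈T y∈X)

  fresh-beside : ∀ {T X} → ∣ T ∣ ≡ j → X ∈F F → ∀ v → ∃ λ x → x ∉ T × x ∉ X × x ≢ v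
  fresh-beside {T} {X} ∣T∣ X∈F v =
    let (x , x∉) = fresh {3} (T ∪ (X ∪ ⁅ v ⁆)) (begin
          ∣ T ∪ (X ∪ ⁅ v ⁆) ∣  ≤⟨ ∣p∪q∣≤ {p = T} (≤-reflexive ∣T∣) (∣p∪⁅x⁆∣≤ {p = X} (≤-reflexive (uniform X X∈F))) ⟩
          j + suc (2 + j)      ≡⟨ arith j ⟩
          j + j + 3            ∎) (m≤m+n 4 100)
        x∉X∪v = x∉p∪q⇒x∉q {p = T} x∉
    in x , x∉p∪q⇒x∉p x∉ , x∉p∪q⇒x∉p x∉X∪v , x∉⁅y⁆⇒x≢y (x∉p∪q⇒x∉q {p = X} x∉X∪v)
    where
    open ≤-Reasoning
    arith : ∀ j → j + suc (2 + j) ≡ j + j + 3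
    arith = solve-∀

  -- Take the edge from `v` to some `x` outside `X`: `X` meets the corresponding member, yet misses
  -- both `T` and `x`.
  star-centre-∈ : ∀ {T v X} → ∣ T ∣ ≡ j → Star T v → X ∈F F → Disjoint T X → v ∈ X
  star-centre-∈ {T} {v} {X} ∣T∣ s X∈F T∩X
    with fresh-beside ∣T∣ X∈F v
  ... | x , x∉T , x∉X , x≢v with meets {Z = (T ∪ ⁅ v ⁆) ∪ ⁅ x ⁆} X∈F (full s x∉T x≢v) T∩X
  ... | y , y∈X , y∈ with ∈-spoke⁻ (p─q⊆p _ T y∈)
  ... | inj₁ y∈T = contradiction y∈X (T∩X y∈T)
  ... | inj₂ (inj₁ refl) = y∈X
  ... | inj₂ (inj₂ refl) = contradiction y∈X x∉X

  -- The leaf `x` is chosen outside `P`, `T`, `Q` and `v`. In use, `P` is another `j`-set and `Q`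
  -- its token, which the member can then meet only in `v`.
  star-member : ∀ {T v} P Q → ∣ T ∣ ≡ j → Star T v → ∣ P ∣ ≤ j → ∣ Q ∣ ≤ 4 → Disjoint P T → Disjoint P ⁅ v ⁆ → Disjoint T Q →
    ∃ λ X → X ∈F F × Disjoint P X × (∀ {y} → y ∈ X → y ∈ Q → y ≡ v)
  star-member {T} {v} P Q ∣T∣ s P≤ Q≤ P∩T v∉P T∩Q
    with fresh {5} ((P ∪ T) ∪ (Q ∪ ⁅ v ⁆))
           (∣p∪q∣≤ {p = P ∪ T} (∣p∪q∣≤ {p = P} P≤ (≤-reflexive ∣T∣)) (∣p∪⁅x⁆∣≤ {p = Q} Q≤)) (m≤m+n 6 98)
  ... | x , x∉ = X , full s x∉T x≢v , P∩X , only
    where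
    X = (T ∪ ⁅ v ⁆) ∪ ⁅ x ⁆
    x∉P = x∉p∪q⇒x∉p (x∉p∪q⇒x∉p x∉)
    x∉T = x∉p∪q⇒x∉q {p = P} (x∉p∪q⇒x∉p x∉)
    x∉Q = x∉p∪q⇒x∉p (x∉p∪q⇒x∉q {p = P ∪ T} x∉)
    x≢v = x∉⁅y⁆⇒x≢y (x∉p∪q⇒x∉q {p = Q} (x∉p∪q⇒x∉q {p = P ∪ T} x∉))
    P∩X : Disjoint P X
    P∩X y∈P = x∉p∪q (x∉p∪q (P∩T y∈P) (v∉P y∈P)) (λ y∈x → x∉P (subst (_∈ P) (x∈⁅y⁆⇒x≡y x y∈x) y∈P))
    only : ∀ {y} → y ∈ X → y ∈ Q → y ≡ v
    only y∈X y∈Q with ∈-spoke⁻ y∈X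
    ... | inj₁ y∈T = contradiction y∈Q (T∩Q y∈T)
    ... | inj₂ (inj₁ y≡v) = y≡v
    ... | inj₂ (inj₂ refl) = contradiction y∈Q x∉Q

  matching-size : ∀ {T τ} → ∣ T ∣ ≡ j → Matching T τ → ∣ τ ∣ ≡ 4
  matching-size ∣T∣ m = trans (cong ∣_∣ (support m)) (trans (disjoint⇒∣p∪q∣≡∣p∣+∣q∣ (disjoint m))
    (cong₂ _+_ (∣edge∣≡2 F uniform ∣T∣ (left∈F m) (T⊆left m)) (∣edge∣≡2 F uniform ∣T∣ (right∈F m) (T⊆right m))))

  module _ {T₁ T₂ : Subset n} (∣T₁∣ : ∣ T₁ ∣ ≡ j) (∣T₂∣ : ∣ T₂ ∣ ≡ j) (T₁∩T₂ : Disjoint T₁ T₂) where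

    -- A member from `star-member` misses `T₁`, so it meets both edges of the matching. But it meets
    -- `τ` only in `v`, which cannot lie on two disjoint edges.
    matching-star-clash : ∀ {τ v} → Matching T₁ τ → Star T₂ v → Disjoint T₁ ⁅ v ⁆ → ¬ Disjoint T₂ τ
    matching-star-clash {τ} m s v∉T₁ T₂∩τ =
      let (Z , Z∈F , T₁∩Z , only) = star-member T₁ τ ∣T₂∣ s (≤-reflexive ∣T₁∣) (≤-reflexive (matching-size ∣T₁∣ m)) T₁∩T₂ v∉T₁ T₂∩τ
          (y , y∈Z , y∈X) = meets Z∈F (left∈F m) T₁∩Z
          (z , z∈Z , z∈Y) = meets Z∈F (right∈F m) T₁∩Z
          y≡v = only y∈Z (subst (y ∈_) (sym (support m)) (p⊆p∪q (right m ─ T₁) y∈X))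
          z≡v = only z∈Z (subst (z ∈_) (sym (support m)) (q⊆p∪q (left m ─ T₁) (right m ─ T₁) z∈Y))
      in disjoint m y∈X (subst (_∈ right m ─ T₁) (trans z≡v (sym y≡v)) z∈Y)

    -- Each edge at `T₁` meets both edges at `T₂`. As these are disjoint, the two meeting points
    -- differ and make up the whole edge.
    matching⊆matching : ∀ {τ₁ τ₂} → Matching T₁ τ₁ → Matching T₂ τ₂ → Disjoint T₁ τ₂ → Disjoint T₂ τ₁ → τ₁ ⊆ τ₂
    matching⊆matching {τ₁} {τ₂} m₁ m₂ T₁∩τ₂ T₂∩τ₁ z∈ =
      [ edge⊆ (left∈F m₁) (T⊆left m₁) (⊆τ₁ ∘ p⊆p∪q (right m₁ ─ T₁))
      , edge⊆ (right∈F m₁) (T⊆right m₁) (⊆τ₁ ∘ q⊆p∪q (left m₁ ─ T₁) (right m₁ ─ T₁)) ]′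
        (x∈p∪q⁻ (left m₁ ─ T₁) (right m₁ ─ T₁) (subst (_ ∈_) (support m₁) z∈))
      where
      ⊆τ₁ : (left m₁ ─ T₁) ∪ (right m₁ ─ T₁) ⊆ τ₁
      ⊆τ₁ = ⊆-reflexive (sym (support m₁))
      ⊆τ₂ : (left m₂ ─ T₂) ∪ (right m₂ ─ T₂) ⊆ τ₂
      ⊆τ₂ = ⊆-reflexive (sym (support m₂))
      X⊆τ₂ : left m₂ ─ T₂ ⊆ τ₂
      X⊆τ₂ = ⊆τ₂ ∘ p⊆p∪q (right m₂ ─ T₂)
      Y⊆τ₂ : right m₂ ─ T₂ ⊆ τ₂
      Y⊆τ₂ = ⊆τ₂ ∘ q⊆p∪q (left m₂ ─ T₂) (right m₂ ─ T₂)
      common : ∀ {Z X} → Z ∈F F → X ∈F F → X ─ T₂ ⊆ τ₂ → Z ─ T₁ ⊆ τ₁ → ∃ λ y → y ∈ X ─ T₂ × y ∈ Z ─ T₁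
      common {Z} {X} Z∈F X∈F X⊆τ₂ Z⊆τ₁ =
        let (y , y∈X , y∈Z) = meets X∈F Z∈F T₁∩X
        in y , x∈p∧x∉q⇒x∈p─q y∈X (λ y∈T₂ → T₂∩τ₁ y∈T₂ (Z⊆τ₁ y∈Z)) , y∈Z
        where
        T₁∩X : Disjoint T₁ X
        T₁∩X y∈T₁ y∈X = T₁∩τ₂ y∈T₁ (X⊆τ₂ (x∈p∧x∉q⇒x∈p─q y∈X (T₁∩T₂ y∈T₁)))
      edge⊆ : ∀ {Z} → Z ∈F F → T₁ ⊆ Z → Z ─ T₁ ⊆ τ₁ → Z ─ T₁ ⊆ τ₂
      edge⊆ Z∈F T₁⊆Z Z⊆τ₁ z∈Z with common Z∈F (left∈F m₂) X⊆τ₂ Z⊆τ₁ | common Z∈F (right∈F m₂) Y⊆τ₂ Z⊆τ₁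
      ... | x , x∈X , x∈Z | y , y∈Y , y∈Z
        with size-2 (∣edge∣≡2 F uniform ∣T₁∣ Z∈F T₁⊆Z) x∈Z y∈Z (λ { refl → disjoint m₂ x∈X y∈Y }) z∈Z
      ... | inj₁ refl = X⊆τ₂ x∈X
      ... | inj₂ refl = Y⊆τ₂ y∈Y

  -- For two stars, a member from the second misses `T₁`, so it contains `v`; by its construction
  -- this forces `v ≡ w`. A star and a matching clash, and two supports include each other.
  tokens-agree : ∀ {T₁ T₂ τ₁ τ₂} → ∣ T₁ ∣ ≡ j → ∣ T₂ ∣ ≡ j → Disjoint T₁ T₂ → Token T₁ τ₁ → Token T₂ τ₂ →
    Disjoint T₁ τ₂ → Disjoint T₂ τ₁ → τ₁ ≡ τ₂
  tokens-agree {T₁} {T₂} ∣T₁∣ ∣T₂∣ T₁∩T₂ (inj₁ (v , s₁ , refl)) (inj₁ (w , s₂ , refl)) T₁∩τ₂ T₂∩τ₁ =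
    let (Z , Z∈F , T₁∩Z , only) = star-member T₁ ⁅ v ⁆ ∣T₂∣ s₂ (≤-reflexive ∣T₁∣)
                                    (subst (_≤ 4) (sym (∣⁅x⁆∣≡1 v)) (s≤s z≤n)) T₁∩T₂ T₁∩τ₂ T₂∩τ₁
    in cong ⁅_⁆ (only (star-centre-∈ ∣T₁∣ s₁ Z∈F T₁∩Z) (x∈⁅x⁆ v))
  tokens-agree ∣T₁∣ ∣T₂∣ T₁∩T₂ (inj₂ m₁) (inj₁ (w , s₂ , refl)) T₁∩τ₂ T₂∩τ₁ =
    contradiction (λ {_} → T₂∩τ₁) (matching-star-clash ∣T₁∣ ∣T₂∣ T₁∩T₂ m₁ s₂ T₁∩τ₂)
  tokens-agree ∣T₁∣ ∣T₂∣ T₁∩T₂ (inj₁ (v , s₁ , refl)) (inj₂ m₂) T₁∩τ₂ T₂∩τ₁ =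
    contradiction (λ {_} → T₁∩τ₂) (matching-star-clash ∣T₂∣ ∣T₁∣ (λ x∈T₂ x∈T₁ → T₁∩T₂ x∈T₁ x∈T₂) m₂ s₁ T₂∩τ₁)
  tokens-agree ∣T₁∣ ∣T₂∣ T₁∩T₂ (inj₂ m₁) (inj₂ m₂) T₁∩τ₂ T₂∩τ₁ = ⊆-antisym
    (matching⊆matching ∣T₁∣ ∣T₂∣ T₁∩T₂ m₁ m₂ T₁∩τ₂ T₂∩τ₁)
    (matching⊆matching ∣T₂∣ ∣T₁∣ (λ x∈T₂ x∈T₁ → T₁∩T₂ x∈T₁ x∈T₂) m₂ m₁ T₂∩τ₁ T₁∩τ₂)

  tokenOf : ∀ T → ∣ T ∣ ≡ j → ∃ (Token T)
  tokenOf T ∣T∣ with star-or-matchings T ∣T∣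
  ... | inj₁ (v , s) = ⁅ v ⁆ , inj₁ (v , s , refl)
  ... | inj₂ ms = let (τ , m , _) = ms ⊥ (subst (_≤ 4) (sym (∣⊥∣≡0 n)) z≤n) in τ , inj₂ m

  -- ⊥ is a junk value: token is only used on j-sets.
  token : Subset n → Subset n
  token T with ∣ T ∣ ≟ j
  ... | yes ∣T∣ = proj₁ (tokenOf T ∣T∣)
  ... | no _ = ⊥

  token-Token : ∀ T → ∣ T ∣ ≡ j → Token T (token T)
  token-Token T ∣T∣ with ∣ T ∣ ≟ j
  ... | yes p = proj₂ (tokenOf T p)
  ... | no ¬p = contradiction ∣T∣ ¬p

  tokens : List (Subset n)
  tokens = subsetsOfSize n 1 ++ subsetsOfSize n 4

  Token∈tokens : ∀ {T τ} → ∣ T ∣ ≡ j → Token T τ → τ ∈ˡ tokens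
  Token∈tokens _ (inj₁ (v , _ , refl)) = ∈-++⁺ˡ (∈-subsetsOfSize⁺ {p = ⁅ v ⁆} (∣⁅x⁆∣≡1 v))
  Token∈tokens ∣T∣ (inj₂ m) = ∈-++⁺ʳ (subsetsOfSize n 1) (∈-subsetsOfSize⁺ (matching-size ∣T∣ m))

  tokens-≤4 : ∀ {τ} → τ ∈ˡ tokens → ∣ τ ∣ ≤ 4
  tokens-≤4 τ∈ with ∈-++⁻ (subsetsOfSize n 1) τ∈
  ... | inj₁ τ∈₁ = subst (_≤ 4) (sym (∈-subsetsOfSize⁻ {d = 1} τ∈₁)) (s≤s z≤n)
  ... | inj₂ τ∈₄ = ≤-reflexive (∈-subsetsOfSize⁻ {d = 4} τ∈₄)

  -- The token game on a set and its complement

  module _ (V : Subset n) (∣V∣ : ∣ V ∣ ≡ j + N * 4) where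

    Inside : Subset n → Set
    Inside P = ∃ λ T → T ⊆ P × ∣ T ∣ ≡ j

    Avoids : ∀ {P} → Inside P → Subset n → Set
    Avoids (T , _) τ = Disjoint T τ

    -- Deleting the tokens `ts` from `P` costs at most 4 elements each, so `j` elements remain.
    avoid : ∀ P M → j + M * 4 ≤ ∣ P ∣ → ∀ ts → length ts ≤ M → (∀ {t} → t ∈ˡ ts → t ∈ˡ tokens) →
      ∃ λ (p : Inside P) → ∀ {t} → t ∈ˡ ts → Avoids p t
    avoid P M room ts len ts⊆ =
      let (T , T⊆ , ∣T∣) = ∃⊆-of-size (P ─ ⋃ ts) {j} (+-cancelʳ-≤ (M * 4) j _ (begin
            j + M * 4                     ≤⟨ room ⟩
            ∣ P ∣                         ≤⟨ ∣p∣≤∣p─q∣+∣q∣ P (⋃ ts) ⟩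
            ∣ P ─ ⋃ ts ∣ + ∣ ⋃ ts ∣       ≤⟨ +-monoʳ-≤ ∣ P ─ ⋃ ts ∣ (≤-trans (∣⋃∣≤ ts (tokens-≤4 ∘ ts⊆)) (*-monoˡ-≤ 4 len)) ⟩
            ∣ P ─ ⋃ ts ∣ + M * 4          ∎))
      in (T , (λ {_} → p─q⊆p P (⋃ ts) ∘ T⊆) , ∣T∣) , λ t∈ x∈T x∈t → x∈p─q⇒x∉q P (⋃ ts) (T⊆ x∈T) (∈-⋃ t∈ x∈t)
      where open ≤-Reasoning

    response? : ∀ x y → Dec (∃ λ (l : Inside (∁ V)) → Avoids l x × token (proj₁ l) ≡ y)
    response? x y = map′
      (λ (T , T⊆ , ∣T∣ , empty , eq) → (T , (λ {_} → T⊆) , ∣T∣) , (λ {_} z∈T z∈x → empty (_ , x∈p∩q⁺ (z∈T , z∈x))) , eq)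
      (λ ((T , T⊆ , ∣T∣) , T∩x , eq) → T , (λ {_} → T⊆) , ∣T∣ , (λ (z , z∈) → let (z∈T , z∈x) = x∈p∩q⁻ T x z∈ in T∩x z∈T z∈x) , eq)
      (anySubset? (λ T → (T ⊆? ∁ V) ×-dec (∣ T ∣ ≟ j) ×-dec ¬? (nonempty? (T ∩ x)) ×-dec (≡-dec Bool._≟_ (token T) y)))

    room∁ : j + suc N * 4 ≤ ∣ ∁ V ∣
    room∁ = subst (j + suc N * 4 ≤_) (sym (trans (∣∁p∣≡n∸∣p∣ V) (cong (n ∸_) ∣V∣)))
      (m+n≤o⇒m≤o∸n (j + suc N * 4) two-parts)

    TokenInside : ∀ {P} → Inside P → Subset n → Set
    TokenInside (T , _) = Token T

    agree : ∀ {l : Inside (∁ V)} {r : Inside V} {τ} → TokenInside r τ → Avoids l τ →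
      Avoids r (token (proj₁ l)) → token (proj₁ l) ≡ τ
    agree {T₁ , T₁⊆ , ∣T₁∣} {T₂ , T₂⊆ , ∣T₂∣} = tokens-agree ∣T₁∣ ∣T₂∣
      (λ x∈T₁ x∈T₂ → x∈∁p⇒x∉p (T₁⊆ x∈T₁) (T₂⊆ x∈T₂)) (token-Token T₁ ∣T₁∣)

    left∈tokens : (l : Inside (∁ V)) → token (proj₁ l) ∈ˡ tokens
    left∈tokens (T , _ , ∣T∣) = Token∈tokens ∣T∣ (token-Token T ∣T∣)

    right∈tokens : ∀ {r : Inside V} {τ} → TokenInside r τ → τ ∈ˡ tokens
    right∈tokens {_ , _ , ∣T∣} = Token∈tokens ∣T∣

    rightToken : (r : Inside V) → ∃ (TokenInside r)
    rightToken (T , _ , ∣T∣) = tokenOf T ∣T∣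

    length-tokens : length tokens < 2 ^ N
    length-tokens = subst (_< 2 ^ N) (sym (length-++ (subsetsOfSize n 1))) few

    avoidˡ = avoid (∁ V) (suc N) room∁
    avoidʳ = avoid V N (≤-reflexive (sym ∣V∣))

    open TokenGame {L = Inside (∁ V)} {R = Inside V} (≡-dec Bool._≟_) Avoids Avoids (token ∘ proj₁) TokenInside
      (λ {l} {r} {τ} → agree {l} {r} {τ}) response? tokens left∈tokens (λ {r} → right∈tokens {r}) rightToken
      N length-tokens avoidˡ avoidʳ

    abstract
      -- The game forces one token `t`. A link graph with matchings has one whose support is not
      -- `t`, so a set `T₀` avoiding `t` has a star, with `t` as its centre. The same reasoning then
      -- covers every `T` in `V` without `v`.
      local-centre : ∃ λ v → ∀ {T} → T ⊆ V → ∣ T ∣ ≡ j → v ∉ T → Star T v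
      local-centre with forced-token
      ... | t , t∈ , forced with avoidʳ (t ∷ []) (≤-trans (s≤s z≤n) 13≤N) (λ { (here refl) → t∈ })
      ... | (T₀ , T₀⊆V , ∣T₀∣) , avoids with star-or-matchings T₀ ∣T₀∣
      ... | inj₂ ms = let (τ , m , τ≢t) = ms t (tokens-≤4 t∈)
                      in contradiction (forced {r = T₀ , (λ {_} → T₀⊆V) , ∣T₀∣} (avoids (here refl)) (inj₂ m)) τ≢t
      ... | inj₁ (v , s₀) = v , stars
        where
        t≡⁅v⁆ : t ≡ ⁅ v ⁆
        t≡⁅v⁆ = sym (forced {r = T₀ , (λ {_} → T₀⊆V) , ∣T₀∣} (avoids (here refl)) (inj₁ (v , s₀ , refl)))
        only-t : ∀ {T τ} → T ⊆ V → ∣ T ∣ ≡ j → v ∉ T → Token T τ → τ ≡ t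
        only-t {T} T⊆V ∣T∣ v∉T = forced {r = T , (λ {_} → T⊆V) , ∣T∣}
          (λ x∈T x∈t → v∉T (subst (_∈ T) (x∈⁅y⁆⇒x≡y v (subst (_ ∈_) t≡⁅v⁆ x∈t)) x∈T))
        stars : ∀ {T} → T ⊆ V → ∣ T ∣ ≡ j → v ∉ T → Star T v
        stars {T} T⊆V ∣T∣ v∉T with star-or-matchings T ∣T∣
        ... | inj₁ (w , s) =
          subst (Star T) (⁅⁆-injective (trans (only-t T⊆V ∣T∣ v∉T (inj₁ (w , s , refl))) t≡⁅v⁆)) s
        ... | inj₂ ms = let (τ , m , τ≢t) = ms t (tokens-≤4 t∈)
                        in contradiction (only-t T⊆V ∣T∣ v∉T (inj₂ m)) τ≢t

  j+N*4≤n : j + N * 4 ≤ n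
  j+N*4≤n = ≤-trans (m≤n+m (j + N * 4) (j + suc N * 4)) two-parts

  j+52≤j+N*4 : j + 52 ≤ j + N * 4
  j+52≤j+N*4 = +-monoʳ-≤ j (*-monoˡ-≤ 4 13≤N)

  -- Carrying the centre from one j-set to another

  star-unique : ∀ {T v w} → ∣ T ∣ ≡ j → Star T v → Star T w → w ≡ v
  star-unique {T} {v} {w} ∣T∣ s s′ with fresh-near {2} ((T ∪ ⁅ v ⁆) ∪ ⁅ w ⁆)
    (∣p∪⁅x⁆∣≤ {p = T ∪ ⁅ v ⁆} (∣p∪⁅x⁆∣≤ {p = T} (≤-reflexive ∣T∣))) (m≤m+n 3 101)
  ... | x , x∉ with ∈-spoke⁻ (centre s′
                     (full s (x∉p∪q⇒x∉p (x∉p∪q⇒x∉p x∉)) (x∉⁅y⁆⇒x≢y (x∉p∪q⇒x∉q {p = T} (x∉p∪q⇒x∉p x∉))))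
                     (p⊆p∪q ⁅ x ⁆ ∘ p⊆p∪q ⁅ v ⁆))
  ... | inj₁ w∈T = contradiction w∈T (centre∉ s′)
  ... | inj₂ (inj₁ w≡v) = w≡v
  ... | inj₂ (inj₂ refl) = contradiction (x∈⁅x⁆ x) (x∉p∪q⇒x∉q {p = T ∪ ⁅ v ⁆} x∉)

  -- A member using the edge from `w` to `x` would be T ∪ {c, x}, which contains `T` but not the
  -- centre `v`.
  replaced-star-clash : ∀ {T v w c} → ∣ T ∣ ≡ j → Star T v → w ∈ T → c ∉ T → c ≢ v → ¬ Star (replace T w c) w
  replaced-star-clash {T} {v} {w} {c} ∣T∣ s w∈T c∉T c≢v s′ with fresh-near {2} ((T ∪ ⁅ c ⁆) ∪ ⁅ v ⁆)
    (∣p∪⁅x⁆∣≤ {p = T ∪ ⁅ c ⁆} (∣p∪⁅x⁆∣≤ {p = T} (≤-reflexive ∣T∣))) (m≤m+n 3 101)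
  ... | x , x∉ = v∉ (centre s (full s′ x∉T′ (λ { refl → x∉T w∈T })) T⊆)
    where
    x∉T : x ∉ T
    x∉T = x∉p∪q⇒x∉p (x∉p∪q⇒x∉p x∉)
    x∉T′ : x ∉ replace T w c
    x∉T′ x∈ with ∈-replace⁻ x∈
    ... | inj₁ (x∈T , _) = x∉T x∈T
    ... | inj₂ refl = x∉p∪q⇒x∉q {p = T} (x∉p∪q⇒x∉p x∉) (x∈⁅x⁆ x)
    T⊆ : T ⊆ (replace T w c ∪ ⁅ w ⁆) ∪ ⁅ x ⁆
    T⊆ {y} y∈T with y Fin.≟ w
    ... | yes refl = p⊆p∪q ⁅ x ⁆ (q⊆p∪q (replace T w c) ⁅ w ⁆ (x∈⁅x⁆ w))
    ... | no y≢w = p⊆p∪q ⁅ x ⁆ (p⊆p∪q ⁅ w ⁆ (p⊆p∪q ⁅ c ⁆ (x∈p∧x≢y⇒x∈p-y y∈T y≢w)))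
    v∉ : v ∉ (replace T w c ∪ ⁅ w ⁆) ∪ ⁅ x ⁆
    v∉ v∈ with ∈-spoke⁻ v∈
    ... | inj₂ (inj₁ refl) = centre∉ s w∈T
    ... | inj₂ (inj₂ refl) = x∉p∪q⇒x∉q {p = T ∪ ⁅ c ⁆} x∉ (x∈⁅x⁆ x)
    ... | inj₁ v∈T′ with ∈-replace⁻ v∈T′
    ... | inj₁ (v∈T , _) = centre∉ s v∈T
    ... | inj₂ refl = c≢v refl

  replace⊆ : ∀ {T V : Subset n} {a b} → T ⊆ V → b ∈ V → replace T a b ⊆ V
  replace⊆ T⊆V b∈V x∈ with ∈-replace⁻ x∈
  ... | inj₁ (x∈T , _) = T⊆V x∈T
  ... | inj₂ refl = b∈V

  -- Enclose `T` and `b` in a set `V` with local centre `w`. If `w` is not in `T`, uniqueness of the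
  -- centre gives `w ≡ v`, and the replaced set also lies in `V` and misses `v`.
  star-replace : ∀ {T v a b} → ∣ T ∣ ≡ j → Star T v → a ∈ T → b ∉ T → b ≢ v → Star (replace T a b) v
  star-replace {T} {v} {a} {b} ∣T∣ s a∈T b∉T b≢v
    with ∃⊇-of-size (T ∪ ⁅ b ⁆) {j + N * 4} (begin
      ∣ T ∪ ⁅ b ⁆ ∣  ≤⟨ ∣p∪⁅x⁆∣≤ {p = T} (≤-reflexive ∣T∣) ⟩
      1 + j          ≡⟨ +-comm 1 j ⟩
      j + 1          ≤⟨ +-monoʳ-≤ j (m≤m+n 1 51) ⟩
      j + 52         ≤⟨ j+52≤j+N*4 ⟩
      j + N * 4      ∎) j+N*4≤n
    where open ≤-Reasoning
  ... | V , ⊆V , ∣V∣ with local-centre V ∣V∣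
  ... | w , stars with w ∈? T
  ... | no w∉T with refl ← star-unique ∣T∣ s (stars (⊆V ∘ p⊆p∪q ⁅ b ⁆) ∣T∣ w∉T) =
    stars (replace⊆ (⊆V ∘ p⊆p∪q ⁅ b ⁆) (⊆V (q⊆p∪q T ⁅ b ⁆ (x∈⁅x⁆ b)))) (trans (∣replace∣ a∈T b∉T) ∣T∣) v∉
    where
    v∉ : v ∉ replace T a b
    v∉ v∈ with ∈-replace⁻ v∈
    ... | inj₁ (v∈T , _) = centre∉ s v∈T
    ... | inj₂ v≡b = b≢v (sym v≡b)
  -- If `w` is in `T`, exchange it for some `c` in `V`: the new set has a star centred at `w`, which
  -- contradicts the star of `T` at `v`.
  ... | yes w∈T with 0<∣p∣⇒Nonempty (V ─ (T ∪ ⁅ v ⁆)) (+-cancelʳ-≤ (suc j) 1 _ (begin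
      1 + suc j                                ≡⟨ +-comm 2 j ⟩
      j + 2                                    ≤⟨ +-monoʳ-≤ j (m≤m+n 2 50) ⟩
      j + 52                                   ≤⟨ j+52≤j+N*4 ⟩
      j + N * 4                                ≡⟨ ∣V∣ ⟨
      ∣ V ∣                                    ≤⟨ ∣p∣≤∣p─q∣+∣q∣ V (T ∪ ⁅ v ⁆) ⟩
      ∣ V ─ (T ∪ ⁅ v ⁆) ∣ + ∣ T ∪ ⁅ v ⁆ ∣      ≤⟨ +-monoʳ-≤ ∣ V ─ (T ∪ ⁅ v ⁆) ∣ (∣p∪⁅x⁆∣≤ {p = T} (≤-reflexive ∣T∣)) ⟩
      ∣ V ─ (T ∪ ⁅ v ⁆) ∣ + suc j              ∎))
      where open ≤-Reasoning
  ... | c , c∈ = contradiction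
      (stars (replace⊆ (⊆V ∘ p⊆p∪q ⁅ b ⁆) (p─q⊆p V (T ∪ ⁅ v ⁆) c∈)) (trans (∣replace∣ w∈T c∉T) ∣T∣) w∉)
      (replaced-star-clash ∣T∣ s w∈T c∉T c≢v)
    where
    c∉T : c ∉ T
    c∉T = x∉p∪q⇒x∉p (x∈p─q⇒x∉q V (T ∪ ⁅ v ⁆) c∈)
    c≢v : c ≢ v
    c≢v = x∉⁅y⁆⇒x≢y (x∉p∪q⇒x∉q {p = T} (x∈p─q⇒x∉q V (T ∪ ⁅ v ⁆) c∈))
    w∉ : w ∉ replace T w c
    w∉ w∈ with ∈-replace⁻ w∈
    ... | inj₁ (_ , w≢w) = w≢w refl
    ... | inj₂ refl = c∉T w∈T

  -- Elements of `T ∩ A` are exchanged for elements outside `A`, keeping the centre, until `T`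
  -- misses `A`. The strict bound `d` on the overlap drives the recursion.
  centre-in-all : ∀ {T v A} d → ∣ T ∣ ≡ j → Star T v → A ∈F F → ∣ T ∩ A ∣ < d → v ∈ A
  centre-in-all {T} {v} {A} (suc d) ∣T∣ s A∈F (s≤s small) with v ∈? A | nonempty? (T ∩ A)
  ... | yes v∈A | _ = v∈A
  ... | no _ | no empty = star-centre-∈ ∣T∣ s A∈F (λ x∈T x∈A → empty (_ , x∈p∩q⁺ (x∈T , x∈A)))
  ... | no v∉A | yes (a , a∈) with fresh-beside ∣T∣ A∈F v
  ... | b , b∉T , b∉A , b≢v = centre-in-all d (trans (∣replace∣ a∈T b∉T) ∣T∣) (star-replace ∣T∣ s a∈T b∉T b≢v) A∈F
        (<-≤-trans (p⊂q⇒∣p∣<∣q∣ (shrink , a , a∈ , a∉)) small)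
    where
    a∈T = proj₁ (x∈p∩q⁻ T A a∈)
    shrink : replace T a b ∩ A ⊆ T ∩ A
    shrink x∈ with x∈p∩q⁻ (replace T a b) A x∈
    ... | x∈r , x∈A with ∈-replace⁻ x∈r
    ... | inj₁ (x∈T , _) = x∈p∩q⁺ (x∈T , x∈A)
    ... | inj₂ refl = contradiction x∈A b∉A
    a∉ : a ∉ replace T a b ∩ A
    a∉ a∈′ with ∈-replace⁻ (proj₁ (x∈p∩q⁻ (replace T a b) A a∈′))
    ... | inj₁ (_ , a≢a) = a≢a refl
    ... | inj₂ refl = b∉T a∈T

  -- Remove `v` and another element `x` from `X`. The link graph of the rest is a star at `v`, hence
  -- full by `star-if-centre`, and `X` corresponds to its edge from `v` to `x`.
  all-members : ∀ {v X} → (∀ {Y} → Y ∈F F → v ∈ Y) → ∣ X ∣ ≡ 2 + j → v ∈ X → X ∈F F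
  all-members {v} {X} in-all ∣X∣ v∈X
    with 0<∣p∣⇒Nonempty (X - v) (subst (0 <_) (suc-injective (trans (sym ∣X∣) (∣p∣≡1+∣p-x∣ v∈X))) z<s)
  ... | x , x∈X-v = subst (_∈F F)
      (⊆-antisym (∪-lub (∪-lub (p─q⊆p X ⁅ v ⁆ ∘ p─q⊆p (X - v) ⁅ x ⁆) (⁅x⁆⊆ v∈X)) (⁅x⁆⊆ (p─q⊆p X ⁅ v ⁆ x∈X-v))) X⊆)
      (full (star-if-centre ∣T∣ v∉T (λ Y∈F _ → in-all Y∈F)) x∉T (x∉⁅y⁆⇒x≢y (x∈p─q⇒x∉q X ⁅ v ⁆ x∈X-v)))
    where
    T = X - v - x
    ∣T∣ : ∣ T ∣ ≡ j
    ∣T∣ = suc-injective (suc-injective (trans (cong suc (sym (∣p∣≡1+∣p-x∣ x∈X-v))) (trans (sym (∣p∣≡1+∣p-x∣ v∈X)) ∣X∣)))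
    v∉T : v ∉ T
    v∉T v∈ = x∈p─q⇒x∉q X ⁅ v ⁆ (p─q⊆p (X - v) ⁅ x ⁆ v∈) (x∈⁅x⁆ v)
    x∉T : x ∉ T
    x∉T x∈ = x∈p─q⇒x∉q (X - v) ⁅ x ⁆ x∈ (x∈⁅x⁆ x)
    X⊆ : X ⊆ (T ∪ ⁅ v ⁆) ∪ ⁅ x ⁆
    X⊆ {y} y∈X with y Fin.≟ v | y Fin.≟ x
    ... | yes refl | _ = p⊆p∪q ⁅ x ⁆ (q⊆p∪q T ⁅ v ⁆ (x∈⁅x⁆ v))
    ... | no _ | yes refl = q⊆p∪q (T ∪ ⁅ v ⁆) ⁅ x ⁆ (x∈⁅x⁆ x)
    ... | no y≢v | no y≢x = p⊆p∪q ⁅ x ⁆ (p⊆p∪q ⁅ v ⁆ (x∈p∧x≢y⇒x∈p-y (x∈p∧x≢y⇒x∈p-y y∈X y≢v) y≢x))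

  complete-star : CompleteStar (2 + j) F
  complete-star with ∃⊇-of-size ⊥ {j + N * 4} (subst (_≤ j + N * 4) (sym (∣⊥∣≡0 n)) z≤n) j+N*4≤n
  ... | V , _ , ∣V∣ with local-centre V ∣V∣
  ... | v , stars with ∃⊆-of-size (V - v) {j} (+-cancelʳ-≤ 1 j _ (begin
      j + 1                  ≤⟨ +-monoʳ-≤ j (m≤m+n 1 51) ⟩
      j + 52                 ≤⟨ j+52≤j+N*4 ⟩
      j + N * 4              ≡⟨ ∣V∣ ⟨
      ∣ V ∣                  ≤⟨ ∣p∣≤∣p─q∣+∣q∣ V ⁅ v ⁆ ⟩
      ∣ V - v ∣ + ∣ ⁅ v ⁆ ∣  ≡⟨ cong (∣ V - v ∣ +_) (∣⁅x⁆∣≡1 v) ⟩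
      ∣ V - v ∣ + 1          ∎))
      where open ≤-Reasoning
  ... | T , T⊆ , ∣T∣ = v , λ X → mk⇔ (λ X∈F → uniform X X∈F , in-all X∈F) (λ (∣X∣ , v∈X) → all-members in-all ∣X∣ v∈X)
    where
    s : Star T v
    s = stars (p─q⊆p V ⁅ v ⁆ ∘ T⊆) ∣T∣ (λ v∈ → x∈p─q⇒x∉q V ⁅ v ⁆ (T⊆ v∈) (x∈⁅x⁆ v))
    in-all : ∀ {X} → X ∈F F → v ∈ X
    in-all {X} X∈F = centre-in-all (suc ∣ T ∩ X ∣) ∣T∣ s X∈F ≤-refl

-- The degrees of a complete star

module _ {n j : ℕ} {F : Family n} (2+j≤n : 2 + j ≤ n) (star : CompleteStar (2 + j) F) where

  private
    v = proj₁ star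

    uniform : Uniform (2 + j) F
    uniform X X∈F = proj₁ (Equivalence.to (proj₂ star X) X∈F)

    n∸[1+j] : n ∸ suc j ≡ n ∸ (2 + j) + 1
    n∸[1+j] = begin
      n ∸ suc j            ≡⟨ cong (_∸ (2 + j)) (+-comm 1 n) ⟩
      (n + 1) ∸ (2 + j)    ≡⟨ +-∸-comm 1 2+j≤n ⟩
      n ∸ (2 + j) + 1      ∎
      where open ≡-Reasoning

    ∣∁[T∪⁅u⁆]∣ : ∀ {T : Subset n} {u} → ∣ T ∣ ≡ j → u ∉ T → ∣ ∁ (T ∪ ⁅ u ⁆) ∣ ≡ n ∸ (2 + j) + 1
    ∣∁[T∪⁅u⁆]∣ {T} {u} ∣T∣ u∉T = trans (∣∁p∣≡n∸∣p∣ (T ∪ ⁅ u ⁆)) (trans (cong (n ∸_) (trans (∣p∪⁅x⁆∣≡1+∣p∣ u∉T) (cong suc ∣T∣))) n∸[1+j])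

  -- Let `u` be `v` if `T` misses `v`, and any element outside `T` otherwise. Each of the n - j - 1
  -- = n - k + 1 elements `x` outside T ∪ {u} gives a member.
  complete-star-degree-≥ : ∀ T → ∣ T ∣ ≡ j → n ∸ (2 + j) + 1 ≤ degree F T
  complete-star-degree-≥ T ∣T∣ = [ (λ v∈T → from (proj₂ (∃∉ T (subst (_< n) (sym ∣T∣) (<-trans (n<1+n j) 2+j≤n)))) (p⊆p∪q _ v∈T))
                               , (λ v∉T → from v∉T (q⊆p∪q T ⁅ v ⁆ (x∈⁅x⁆ v))) ]′ (toSum (v ∈? T))
    where
    from : ∀ {u} → u ∉ T → v ∈ T ∪ ⁅ u ⁆ → n ∸ (2 + j) + 1 ≤ degree F T
    from {u} u∉T v∈ = subst (_≤ degree F T) (trans (length-elements P) (∣∁[T∪⁅u⁆]∣ ∣T∣ u∉T))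
      (length-≤-by-injection (λ x X → x ∉ T ∪ ⁅ u ⁆ × X ≡ (T ∪ ⁅ u ⁆) ∪ ⁅ x ⁆) inj (elements-unique P) (edges F T) spoke)
      where
      P = ∁ (T ∪ ⁅ u ⁆)
      inj : ∀ {x y X} → x ∉ T ∪ ⁅ u ⁆ × X ≡ (T ∪ ⁅ u ⁆) ∪ ⁅ x ⁆ → y ∉ T ∪ ⁅ u ⁆ × X ≡ (T ∪ ⁅ u ⁆) ∪ ⁅ y ⁆ → x ≡ y
      inj {x} {y} (x∉ , refl) (_ , eq) with x∈p∪q⁻ (T ∪ ⁅ u ⁆) ⁅ y ⁆ (subst (x ∈_) eq (q⊆p∪q (T ∪ ⁅ u ⁆) ⁅ x ⁆ (x∈⁅x⁆ x)))
      ... | inj₁ x∈ = contradiction x∈ x∉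
      ... | inj₂ x∈y = x∈⁅y⁆⇒x≡y y x∈y
      spoke : ∀ {x} → x ∈ˡ elements P → ∃ λ X → X ∈ˡ edges F T × x ∉ T ∪ ⁅ u ⁆ × X ≡ (T ∪ ⁅ u ⁆) ∪ ⁅ x ⁆
      spoke {x} x∈ = (T ∪ ⁅ u ⁆) ∪ ⁅ x ⁆ , ∈-edges⁺ {F = F} {S = T}
          (Equivalence.from (proj₂ star _) (trans (∣p∪⁅x⁆∣≡1+∣p∣ x∉) (cong suc (trans (∣p∪⁅x⁆∣≡1+∣p∣ u∉T) (cong suc ∣T∣))) , p⊆p∪q ⁅ x ⁆ v∈))
          (p⊆p∪q ⁅ x ⁆ ∘ p⊆p∪q ⁅ u ⁆) , x∉ , refl
        where
        x∉ : x ∉ T ∪ ⁅ u ⁆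
        x∉ = x∈∁p⇒x∉p (∈-elements⁻ x∈)

  -- The minimum is attained at a `T` without `v`, since all its edges contain `v`.
  complete-star-δ : δ j F ≡ n ∸ (2 + j) + 1
  complete-star-δ with ∃⊆-of-size (∁ ⁅ v ⁆) {j} (subst (j ≤_) (sym (trans (∣∁p∣≡n∸∣p∣ ⁅ v ⁆) (cong (n ∸_) (∣⁅x⁆∣≡1 v)))) (≤-trans (n≤1+n j) (∸-monoˡ-≤ 1 2+j≤n)))
  ... | T , T⊆ , ∣T∣ = ≤-antisym
      (≤-trans (δ-≤ F {T} ∣T∣) (subst (degree F T ≤_) (∣∁[T∪⁅u⁆]∣ ∣T∣ v∉T)
        (degree-≤-star F uniform (∁ (T ∪ ⁅ v ⁆)) ∣T∣ v∉T (λ {X} X∈F _ → proj₂ (Equivalence.to (proj₂ star X) X∈F))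
          (λ x∉T x≢v _ → x∉p⇒x∈∁p (x∉p∪q x∉T (x≢y⇒x∉⁅y⁆ x≢v))))))
      (≤-δ F {T} ∣T∣ complete-star-degree-≥)
    where
    v∉T : v ∉ T
    v∉T v∈T = x∈∁p⇒x∉p (T⊆ v∈T) (x∈⁅x⁆ v)

-- The number of tokens

-- 24 (x + x⁴/24) bounds 24 times the number of subsets of size 1 or 4 of an x-set.
Few : ℕ → ℕ → Set
Few N x = x ^ 4 + 24 * x < 24 * 2 ^ N

Few-antimono : ∀ N {x y} → x ≤ y → Few N y → Few N x
Few-antimono N x≤y = ≤-<-trans (+-mono-≤ (^-monoˡ-≤ 4 x≤y) (*-monoʳ-≤ 24 x≤y))

-- As (8/7)^4 = 4096/2401 is below 2, growth by a factor 8/7 at most doubles the left side of `Few`,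
-- while the right side doubles exactly.
Few-suc : ∀ N {x y} → 7 * y ≤ 8 * x → Few N x → Few (suc N) y
Few-suc N {x} {y} 7y≤8x few = begin-strict
  y ^ 4 + 24 * y           ≤⟨ +-mono-≤ y⁴≤2x⁴ (*-monoʳ-≤ 24 y≤2x) ⟩
  2 * x ^ 4 + 24 * (2 * x) ≡⟨ arith (x ^ 4) x ⟩
  2 * (x ^ 4 + 24 * x)     <⟨ *-monoʳ-< 2 few ⟩
  2 * (24 * 2 ^ N)         ≡⟨ arith′ (2 ^ N) ⟩
  24 * (2 * 2 ^ N)         ∎
  where
  open ≤-Reasoning
  arith : ∀ a x → 2 * a + 24 * (2 * x) ≡ 2 * (a + 24 * x)
  arith = solve-∀
  arith′ : ∀ a → 2 * (24 * a) ≡ 24 * (2 * a)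
  arith′ = solve-∀
  y≤2x : y ≤ 2 * x
  y≤2x = *-cancelˡ-≤ 7 (begin
    7 * y        ≤⟨ 7y≤8x ⟩
    8 * x        ≤⟨ *-monoˡ-≤ x (m≤m+n 8 6) ⟩
    14 * x       ≡⟨ *-assoc 7 2 x ⟩
    7 * (2 * x)  ∎)
  pow : ∀ c z → (c * z) ^ 4 ≡ c ^ 4 * z ^ 4
  pow = expanded
    where
    expanded : ∀ c z → c * z * (c * z * (c * z * (c * z * 1))) ≡ c * (c * (c * (c * 1))) * (z * (z * (z * (z * 1))))
    expanded = solve-∀
  y⁴≤2x⁴ : y ^ 4 ≤ 2 * x ^ 4
  y⁴≤2x⁴ = *-cancelˡ-≤ 2401 (begin
    2401 * y ^ 4        ≡⟨ pow 7 y ⟨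
    (7 * y) ^ 4         ≤⟨ ^-monoˡ-≤ 4 7y≤8x ⟩
    (8 * x) ^ 4         ≡⟨ pow 8 x ⟩
    4096 * x ^ 4        ≤⟨ *-monoˡ-≤ (x ^ 4) (m≤m+n 4096 706) ⟩
    4802 * x ^ 4        ≡⟨ *-assoc 2401 2 (x ^ 4) ⟩
    2401 * (2 * x ^ 4)  ∎)

Few-growth : ∀ (f : ℕ → ℕ) N₀ → Few N₀ (f 0) → (∀ d → 7 * f (suc d) ≤ 8 * f d) → ∀ d → Few (d + N₀) (f d)
Few-growth f N₀ base step zero = base
Few-growth f N₀ base step (suc d) = Few-suc (d + N₀) {f d} {f (suc d)} (step d) (Few-growth f N₀ base step d)

few-tokens : ∀ n N → Few N n → #subsets n 1 + #subsets n 4 < 2 ^ N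
few-tokens n N few = *-cancelˡ-< 24 _ _ (begin-strict
  24 * (#subsets n 1 + #subsets n 4)       ≡⟨ *-distribˡ-+ 24 (#subsets n 1) (#subsets n 4) ⟩
  24 * #subsets n 1 + 24 * #subsets n 4    ≤⟨ +-mono-≤ (*-monoʳ-≤ 24 one) (#subsets-≤ n 4) ⟩
  24 * n + n ^ 4                           ≡⟨ +-comm (24 * n) (n ^ 4) ⟩
  n ^ 4 + 24 * n                           <⟨ few ⟩
  24 * 2 ^ N                               ∎)
  where
  open ≤-Reasoning
  one : #subsets n 1 ≤ n
  one = subst₂ _≤_ (*-identityˡ (#subsets n 1)) (*-identityʳ n) (#subsets-≤ n 1)

-- Arithmetic of the size bound

cube-root : ∀ k → ∃ λ m → m ^ 3 ≤ k × k < suc m ^ 3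
cube-root zero = 0 , z≤n , s≤s z≤n
cube-root (suc k) with cube-root k
... | m , lo , hi with suc m ^ 3 ≤? suc k
... | yes p = suc m , p , ≤-<-trans hi (^-monoˡ-< 3 (n<1+n (suc m)))
... | no ¬p = m , m≤n⇒m≤1+n lo , ≰⇒> ¬p

module _ {n k : ℕ} (3≤k : 3 ≤ k) (bound : SizeBound n k) where

  bound-at : ∀ m → m ^ 3 ≤ k → 2 * k + (7 * m ^ 2 + 34 * m + 162) ≤ n
  bound-at m m³≤k = subst₂ _≤_ (arith m k) (*-identityʳ n) (bound m 1 z<s (≤-trans m³≤k (≤-reflexive (sym (*-identityʳ k)))))
    where
    arith : ∀ m k → 7 * (m * (m * 1)) * 1 + 34 * m * 1 + (2 * k + 162) * 1 ≡ 2 * k + (7 * (m * (m * 1)) + 34 * m + 162)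
    arith = solve-∀

  bound-at-fraction : ∀ m p → 0 < p → m ^ 3 ≤ k * p ^ 3 →
    2 * k * p ^ 3 + (162 * p ^ 3 + (7 * m ^ 2 * p + 34 * m * p ^ 2)) ≤ n * p ^ 3
  bound-at-fraction m p 0<p m³≤ = ≤-trans (≤-reflexive (arith (2 * k) (p ^ 3) (7 * m ^ 2 * p + 34 * m * p ^ 2))) (bound m p 0<p m³≤)
    where
    arith : ∀ a q x → a * q + (162 * q + x) ≡ x + (a + 162) * q
    arith = solve-∀

  -- 7/5 is a lower bound for the cube root of 3 that suffices for k ≤ 7.
  bound-at-7/5 : 2 * k + 224 ≤ n
  bound-at-7/5 = subst (_≤ n) (sym (+-suc (2 * k) 223)) (*-cancelʳ-< 125 (2 * k + 223) n (begin-strict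
    (2 * k + 223) * 125              ≡⟨ *-distribʳ-+ 125 (2 * k) 223 ⟩
    -- 7665 = 7 · 7² · 5 + 34 · 7 · 5² comes from the cube-root terms at 7/5. Integrality then
    -- raises 223 to 224 = 8 · 28.
    2 * k * 125 + 223 * 125          <⟨ +-monoʳ-< (2 * k * 125) (<ᵇ⇒< (223 * 125) (162 * 125 + 7665) tt) ⟩
    2 * k * 125 + (162 * 125 + 7665) ≤⟨ bound-at-fraction 7 5 z<s (≤-trans (m≤m+n 343 32) (*-monoˡ-≤ 125 3≤k)) ⟩
    n * 125                          ∎))
    where open ≤-Reasoning

  private
    -- `N` is the largest number with 2k + 8N ≤ n; it remains to see that 2^N exceeds the number of
    -- tokens.
    s = n ∸ 2 * k
    N = s / 8

    above : ∀ {c} → 2 * k + c ≤ n → c ≤ s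
    above {c} p = m+n≤o⇒m≤o∸n c (subst (_≤ n) (+-comm (2 * k) c) p)

    2k≤n : 2 * k ≤ n
    2k≤n = ≤-trans (m≤m+n (2 * k) 224) bound-at-7/5

    n≡2k+s : n ≡ 2 * k + s
    n≡2k+s = sym (m+[n∸m]≡n 2k≤n)

    N*8≤s : N * 8 ≤ s
    N*8≤s = m/n*n≤m s 8

    s≤7+N*8 : s ≤ 7 + N * 8
    s≤7+N*8 = ≤-trans (≤-reflexive (m≡m%n+[m/n]*n s 8)) (+-monoˡ-≤ (N * 8) (≤-pred (m%n<n s 8)))

    -- `f d` serves as a bound on `n` when `N` is `N₀ + d`; `Few-suc` pays for its growth.
    from-growth : ∀ (f : ℕ → ℕ) N₀ → Few N₀ (f 0) → (∀ d → 7 * f (suc d) ≤ 8 * f d) → N₀ ≤ N → n ≤ f (N ∸ N₀) → Few N n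
    from-growth f N₀ base step N₀≤N n≤ =
      Few-antimono N n≤ (subst (λ M → Few M (f (N ∸ N₀))) (m∸n+n≡m N₀≤N) (Few-growth f N₀ base step (N ∸ N₀)))

    N≥ : ∀ M → M * 8 ≤ s → M ≤ N
    N≥ M M*8≤s = subst (_≤ N) (m*n/n≡m M 8) (/-monoˡ-≤ 8 M*8≤s)

    split : ∀ M → M ≤ N → s ≤ (N ∸ M) * 8 + (M * 8 + 7)
    split M M≤N = ≤-trans s≤7+N*8 (≤-reflexive (trans (cong (λ x → 7 + x * 8) (sym (m∸n+n≡m M≤N))) (arith (N ∸ M) M)))
      where
      arith : ∀ d M → 7 + (d + M) * 8 ≡ d * 8 + (M * 8 + 7)
      arith = solve-∀

    growth : ∀ a e → 7 * a ≤ e → ∀ d → 7 * (suc d * a + e) ≤ 8 * (d * a + e)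
    growth a e 7a≤e d = begin
      7 * (suc d * a + e)                ≡⟨ arith a e d ⟩
      7 * a + (7 * (d * a) + 7 * e)      ≤⟨ +-monoˡ-≤ _ 7a≤e ⟩
      e + (7 * (d * a) + 7 * e)          ≤⟨ m≤n+m _ (d * a) ⟩
      d * a + (e + (7 * (d * a) + 7 * e)) ≡⟨ arith′ (d * a) e ⟩
      8 * (d * a + e)                    ∎
      where
      open ≤-Reasoning
      arith : ∀ a e d → 7 * (suc d * a + e) ≡ 7 * a + (7 * (d * a) + 7 * e)
      arith = solve-∀
      arith′ : ∀ x e → x + (e + (7 * x + 7 * e)) ≡ 8 * (x + e)
      arith′ = solve-∀

    -- As s ≤ 8N + 7, n is at most the given function of N ∸ N₀ as soon as n ≤ s + 14, n ≤ 2s or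
    -- n ≤ s², respectively.
    few-small : k ≤ 7 → Few N n
    -- If `N` is 28, then `n` is at most 14 + (28 · 8 + 7) = 245.
    few-small k≤7 = from-growth (λ d → d * 8 + 245) 28 (<ᵇ⇒< _ _ tt) (growth 8 245 (m≤m+n 56 189)) 28≤N (begin
      n                            ≡⟨ n≡2k+s ⟩
      2 * k + s                    ≤⟨ +-mono-≤ (*-monoʳ-≤ 2 k≤7) (split 28 28≤N) ⟩
      14 + ((N ∸ 28) * 8 + 231)    ≡⟨ +-comm 14 _ ⟩
      (N ∸ 28) * 8 + 231 + 14      ≡⟨ +-assoc ((N ∸ 28) * 8) 231 14 ⟩
      (N ∸ 28) * 8 + 245           ∎)
      where
      open ≤-Reasoning
      28≤N = N≥ 28 (above bound-at-7/5)

    few-medium : 258 ≤ s → 2 * k ≤ s → Few N n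
    -- If `N` is 32, then `s` is at most 32 · 8 + 7 = 263 and `n` at most twice that. Likewise 623 =
    -- 77 · 8 + 7 in `few-large`.
    few-medium 258≤s 2k≤s = from-growth (λ d → d * 16 + 526) 32 (<ᵇ⇒< _ _ tt) (growth 16 526 (m≤m+n 112 414)) 32≤N (begin
      n                                                    ≡⟨ n≡2k+s ⟩
      2 * k + s                                            ≤⟨ +-mono-≤ (≤-trans 2k≤s (split 32 32≤N)) (split 32 32≤N) ⟩
      ((N ∸ 32) * 8 + 263) + ((N ∸ 32) * 8 + 263)          ≡⟨ double (N ∸ 32) 263 ⟩
      (N ∸ 32) * 16 + 526                                  ∎)
      where
      open ≤-Reasoning
      32≤N = N≥ 32 (≤-trans (m≤m+n 256 2) 258≤s)
      double : ∀ d e → (d * 8 + e) + (d * 8 + e) ≡ d * 16 + (e + e)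
      double = solve-∀

    few-large : 618 ≤ s → n ≤ s * s → Few N n
    few-large 618≤s n≤s² = from-growth (λ d → (d * 8 + 623) * (d * 8 + 623)) 77 (<ᵇ⇒< _ _ tt) step 77≤N
      (≤-trans n≤s² (*-mono-≤ (split 77 77≤N) (split 77 77≤N)))
      where
      77≤N = N≥ 77 (≤-trans (m≤m+n 616 2) 618≤s)
      -- The excess 112z + 448 is at most 120z, hence at most z².
      square : ∀ z → 120 ≤ z → 7 * ((8 + z) * (8 + z)) ≤ 8 * (z * z)
      square z 120≤z = begin
        7 * ((8 + z) * (8 + z))              ≡⟨ arith z ⟩
        7 * (z * z) + (112 * z + 448)        ≤⟨ +-monoʳ-≤ (7 * (z * z)) (+-monoʳ-≤ (112 * z) (≤-trans (m≤m+n 448 512) (*-monoʳ-≤ 8 120≤z))) ⟩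
        7 * (z * z) + (112 * z + 8 * z)      ≡⟨ cong (7 * (z * z) +_) (*-distribʳ-+ z 112 8) ⟨
        7 * (z * z) + 120 * z                ≤⟨ +-monoʳ-≤ (7 * (z * z)) (*-monoˡ-≤ z 120≤z) ⟩
        7 * (z * z) + z * z                  ≡⟨ +-comm (7 * (z * z)) (z * z) ⟩
        8 * (z * z)                          ∎
        where
        open ≤-Reasoning
        arith : ∀ z → 7 * ((8 + z) * (8 + z)) ≡ 7 * (z * z) + (112 * z + 448)
        arith = solve-∀
      step : ∀ d → 7 * ((suc d * 8 + 623) * (suc d * 8 + 623)) ≤ 8 * ((d * 8 + 623) * (d * 8 + 623))
      step d = square (d * 8 + 623) (≤-trans (m≤m+n 120 503) (m≤n+m 623 (d * 8)))

    -- With q = m + 1, 2k ≤ 2q³ ≤ (7q²)² and 7q² + 1 ≤ s, so 2k + s ≤ (7q² + 1)s ≤ s².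
    n≤s² : ∀ m → m ^ 3 ≤ k → k < suc m ^ 3 → n ≤ s * s
    n≤s² m lo hi = begin
      n                                ≡⟨ n≡2k+s ⟩
      2 * k + s                        ≤⟨ +-monoˡ-≤ s (*-monoʳ-≤ 2 (<⇒≤ hi)) ⟩
      2 * q ^ 3 + s                    ≤⟨ +-monoˡ-≤ s (≤-trans (*-mono-≤ (m≤m+n 2 47) (m≤n*m (q ^ 3) q)) (≤-reflexive (arith q))) ⟩
      7 * (q * q) * (7 * (q * q)) + s  ≤⟨ +-monoˡ-≤ s (*-monoʳ-≤ (7 * (q * q)) (≤-trans (n≤1+n _) q²≤s)) ⟩
      7 * (q * q) * s + s              ≡⟨ +-comm _ s ⟩
      suc (7 * (q * q)) * s            ≤⟨ *-monoˡ-≤ s q²≤s ⟩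
      s * s                            ∎
      where
      open ≤-Reasoning
      q = suc m
      arith : ∀ q → 49 * (q * (q * (q * (q * 1)))) ≡ 7 * (q * q) * (7 * (q * q))
      arith = solve-∀
      arith′ : ∀ m → suc (7 * (suc m * suc m)) + (20 * m + 154) ≡ 7 * (m * (m * 1)) + 34 * m + 162
      arith′ = solve-∀
      q²≤s : suc (7 * (q * q)) ≤ s
      q²≤s = ≤-trans (≤-trans (m≤m+n _ (20 * m + 154)) (≤-reflexive (arith′ m))) (above (bound-at m lo))

    medium : ∀ m → m ^ 3 ≤ k → k < suc m ^ 3 → 258 ≤ 7 * m ^ 2 + 34 * m + 162 → 2 * suc m ^ 3 ≤ 7 * m ^ 2 + 34 * m + 162 → Few N n
    medium m lo hi p q = few-medium (≤-trans p (above (bound-at m lo))) (≤-trans (≤-trans (*-monoʳ-≤ 2 (<⇒≤ hi)) q) (above (bound-at m lo)))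

    few : Few N n
    few with cube-root k
    ... | 0 , _ , hi = few-small (≤-trans (<⇒≤ hi) (m≤m+n 1 6))
    ... | 1 , _ , hi = few-small (≤-pred hi)
    -- 2(m + 1)³ ≤ 7m² + 34m + 162 holds for m from 2 to 5 and fails at 6. The thresholds 258 and
    -- 618 are the values of the right side at 2 and 6.
    ... | m@2 , lo , hi = medium m lo hi (≤ᵇ⇒≤ _ _ tt) (≤ᵇ⇒≤ _ _ tt)
    ... | m@3 , lo , hi = medium m lo hi (≤ᵇ⇒≤ _ _ tt) (≤ᵇ⇒≤ _ _ tt)
    ... | m@4 , lo , hi = medium m lo hi (≤ᵇ⇒≤ _ _ tt) (≤ᵇ⇒≤ _ _ tt)
    ... | m@5 , lo , hi = medium m lo hi (≤ᵇ⇒≤ _ _ tt) (≤ᵇ⇒≤ _ _ tt)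
    ... | m@(suc (suc (suc (suc (suc (suc m′)))))) , lo , hi = few-large
      (≤-trans (+-monoˡ-≤ 162 (+-mono-≤ (*-monoʳ-≤ 7 (^-monoˡ-≤ 2 6≤m)) (*-monoʳ-≤ 34 6≤m))) (above (bound-at m lo)))
      (n≤s² m lo hi)
      where
      6≤m : 6 ≤ m
      6≤m = m≤m+n 6 m′

  abstract
    ∃-log₂-tokens : ∃ λ N → 13 ≤ N × 2 * k + 8 * N ≤ n × #subsets n 1 + #subsets n 4 < 2 ^ N
    ∃-log₂-tokens = N , ≤-trans (m≤m+n 13 15) (N≥ 28 (above bound-at-7/5))
      , ≤-trans (+-monoʳ-≤ (2 * k) (≤-trans (≤-reflexive (*-comm 8 N)) N*8≤s)) (≤-reflexive (sym n≡2k+s))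
      , few-tokens n N few

-- The bound on the minimum degree and the case of equality

theorem1p3 : ∀ (n k : ℕ) (F : Family n) → 3 ≤ k → Uniform k F → Intersecting F →
    SizeBound n k →
    (δ (k ∸ 2) F ≤ n ∸ k + 1) × ((δ (k ∸ 2) F ≡ n ∸ k + 1) ⇔ CompleteStar k F)
theorem1p3 n (suc zero) F (s≤s ())
theorem1p3 n k@(suc (suc j)) F 3≤k uniform intersecting bound with ∃-log₂-tokens 3≤k bound
... | N , 13≤N , large , few = upper , mk⇔ (star ∘ ≤-reflexive ∘ sym) (complete-star-δ k≤n)
  where
  k≤n : k ≤ n
  k≤n = ≤-trans (≤-trans (m≤m+n k (k + 0)) (m≤m+n (2 * k) (8 * N))) large
  -- Assuming only an inequality lets this serve both the upper bound and the characterisation of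
  -- equality.
  star : n ∸ k + 1 ≤ δ j F → CompleteStar k F
  star high = HighDegree.complete-star F uniform intersecting (λ T ∣T∣ → ≤-trans high (δ-≤ F {T} ∣T∣)) N 13≤N large few
  upper : δ j F ≤ n ∸ k + 1
  upper with ≤-total (δ j F) (n ∸ k + 1)
  ... | inj₁ δ≤ = δ≤
  ... | inj₂ ≤δ = ≤-reflexive (complete-star-δ k≤n (star ≤δ))
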